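{- Let $\pi$ be a partition with $k\ge1$ blocks, and let $u_i=cr(\pi^i)$, $v_i=ne(\pi^i)$ for $1\le i\le k$. Set $b_{0,0}=q^{u_1}p^{v_1}$ and, for $r\ge1$, $b_{0,r}=\sum_{1<i_1<\dots<i_r\le k}q^{u_{i_1}+\dots+u_{i_r}-(r-1)u_1}p^{v_{i_1}+\dots+v_{i_r}-(r-1)v_1}$. Then, as formal power series in $z$, $$S_\pi(q,p,z)=\sum_{s=0}^{k-1}b_{0,s}K_s(z).$$
   Context: Partitions are drawn with arcs joining consecutive elements of each block; $cr(\mu)$, $ne(\mu)$ count pairs of arcs $(i_1,j_1),(i_2,j_2)$ with $i_1<i_2<j_1<j_2$, resp. $i_1<i_2<j_2<j_1$. For a partition $\pi$ of $[n]$ with blocks $B_1,\dots,B_k$ ordered by their minima and $S+1=\{a+1:a\in S\}$, $\pi^{i}=\{\{1\}\cup(B_i+1)\}\cup\{B_t+1:t\ne i\}$ ($1\le i\le k$). The tree of partitions has root the empty partition, and a partition of $[N+1]$ is a child of a partition $\nu$ of $[N]$ iff its restriction to $\{2,\dots,N+1\}$ is order-isomorphic to $\nu$; $\mathcal{T}(\pi,l)$ is the set of descendants of $\pi$ at distance $l$ (partitions of $[n+l]$ whose restriction to the last $n$ elements is order-isomorphic to $\pi$). $S_\pi(q,p,z)=\sum_{l\ge0}\sum_{\lambda\in\mathcal{T}(\pi,l)}q^{cr(\lambda)}p^{ne(\lambda)}z^l$. Let $[r]_{q,p}=\frac{q^r-p^r}{q-p}$, $a_r=[r+1]_{q,p}$,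 $c_r=[r+1]_{q,p}+1$, and $$J^{/h/}(z)=\cfrac{1}{1-c_hz-\cfrac{a_hz^2}{1-c_{h+1}z-\cfrac{a_{h+1}z^2}{\ddots}}},$$ and $K_s(z)=J^{/0/}(z)\,a_0z\,J^{/1/}(z)\,a_1z\cdots a_{s-1}z\,J^{/s/}(z)$ (so $K_0=J^{/0/}$). -}

module Defs where

open import Level using (Level)
open import Data.Bool using (Bool; true; false; _∧_; if_then_else_)
open import Data.Nat using (ℕ; zero; suc; _∸_; _≤ᵇ_; _<ᵇ_; _≡ᵇ_)
import Data.Nat as N
open import Data.Maybe using (Maybe; just; nothing; maybe)
open import Data.Product using (_×_; _,_; proj₁; proj₂)
open import Data.List using (List; []; _∷_; _++_; map; filter; length; upTo; concatMap; drop; foldr)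
open import Data.List.Relation.Unary.All using ()
open import Relation.Nullary.Decidable using (T?)
open import Algebra.Bundles using (CommutativeRing)

-- Set partitions of [N] encoded as label words (list of length N, the
-- t-th entry being the label of the block containing element t+1).
-- Canonical encoding: restricted growth strings (blocks ordered by minima,
-- labelled 0,1,2,...).  cr/ne only depend on which positions share a label.

rgsOk : ℕ → List ℕ → Bool
rgsOk m [] = true
rgsOk m (x ∷ xs) = (x ≤ᵇ m) ∧ rgsOk (if x ≡ᵇ m then suc m else m) xs

isRGS : List ℕ → Bool
isRGS = rgsOk 0

blocksFrom : ℕ → List ℕ → ℕ
blocksFrom m [] = m
blocksFrom m (x ∷ xs) = blocksFrom (if x ≡ᵇ m then suc m else m) xs

nblocks : List ℕ → ℕ
nblocks = blocksFrom 0

findIdx : ℕ → List ℕ → Maybe ℕ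
findIdx x [] = nothing
findIdx x (y ∷ ys) = if x ≡ᵇ y then just 0 else maybe (λ j → just (suc j)) nothing (findIdx x ys)

arcs : List ℕ → List (ℕ × ℕ)
arcs [] = []
arcs (x ∷ xs) =
  let rest = map (λ a → suc (proj₁ a) , suc (proj₂ a)) (arcs xs)
  in maybe (λ j → (0 , suc j) ∷ rest) rest (findIdx x xs)

pairs : {A : Set} → List A → List (A × A)
pairs xs = concatMap (λ a → map (λ b → a , b) xs) xs

count : {A : Set} → (A → Bool) → List A → ℕ
count f xs = length (filter (λ a → T? (f a)) xs)

isCrossing : (ℕ × ℕ) × (ℕ × ℕ) → Bool
isCrossing ((i₁ , j₁) , (i₂ , j₂)) = (i₁ <ᵇ i₂) ∧ (i₂ <ᵇ j₁) ∧ (j₁ <ᵇ j₂)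

isNesting : (ℕ × ℕ) × (ℕ × ℕ) → Bool
isNesting ((i₁ , j₁) , (i₂ , j₂)) = (i₁ <ᵇ i₂) ∧ (i₂ <ᵇ j₂) ∧ (j₂ <ᵇ j₁)

cr : List ℕ → ℕ
cr w = count isCrossing (pairs (arcs w))

ne : List ℕ → ℕ
ne w = count isNesting (pairs (arcs w))

indexOf : ℕ → List ℕ → Maybe ℕ
indexOf = findIdx

std′ : List ℕ → List ℕ → List ℕ
std′ seen [] = []
std′ seen (x ∷ xs) with indexOf x seen
... | just i = i ∷ std′ seen xs
... | nothing = length seen ∷ std′ (seen ++ (x ∷ [])) xs

std : List ℕ → List ℕ
std = std′ []

eqList : List ℕ → List ℕ → Bool
eqList [] [] = true
eqList [] (_ ∷ _) = false
eqList (_ ∷ _) [] = false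
eqList (x ∷ xs) (y ∷ ys) = (x ≡ᵇ y) ∧ eqList xs ys

words : ℕ → ℕ → List (List ℕ)
words A zero = [] ∷ []
words A (suc n) = concatMap (λ x → map (x ∷_) (words A n)) (upTo A)

-- T(π,l): partitions of [n+l] (as RGS) whose restriction to the last n
-- elements is order-isomorphic to π
Tset : List ℕ → ℕ → List (List ℕ)
Tset π l =
  let M = length π N.+ l in
  filter (λ λ′ → T? (isRGS λ′ ∧ eqList (std (drop l λ′)) π)) (words M M)

-- π^i (1 ≤ i ≤ k): new element 1 joins block B_i (label i-1), rest shifted
piUp : List ℕ → ℕ → List ℕ
piUp π i = (i ∸ 1) ∷ π

choose : {A : Set} → ℕ → List A → List (List A)
choose zero xs = [] ∷ []
choose (suc r) [] = []
choose (suc r) (x ∷ xs) = map (x ∷_) (choose r xs) ++ choose (suc r) xs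

-- Ring-valued part: formal power series in z = coefficient functions ℕ → R,
-- with q , p arbitrary elements of an arbitrary commutative ring
-- (equivalently: identities in ℤ[q,p]).

module Series {c ℓ : Level} (R : CommutativeRing c ℓ) (q p : CommutativeRing.Carrier R) where
  open CommutativeRing R

  pow : Carrier → ℕ → Carrier
  pow x zero = 1#
  pow x (suc n) = x * pow x n

  sumL : List Carrier → Carrier
  sumL = foldr _+_ 0#

  sumTo : ℕ → (ℕ → Carrier) → Carrier
  sumTo n f = sumL (map f (upTo n))

  -- [r]_{q,p} = (q^r - p^r)/(q - p) = Σ_{i<r} q^i p^{r-1-i}
  qp : ℕ → Carrier
  qp r = sumTo r (λ i → pow q i * pow p (r ∸ suc i))

  a : ℕ → Carrier
  a r = qp (suc r)

  cc : ℕ → Carrier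
  cc r = qp (suc r) + 1#

  Series : Set c
  Series = ℕ → Carrier

  _⊛_ : Series → Series → Series
  (f ⊛ g) n = sumTo (suc n) (λ i → f i * g (n ∸ i))

  zs : Series → Series
  zs f zero = 0#
  zs f (suc n) = f n

  scale : Carrier → Series → Series
  scale x f n = x * f n

  -- J^{/h/}(z) as the formal power series solution of
  -- J_h = 1 + c_h z J_h + a_h z^2 J_{h+1} J_h, computed with fuel
  Jf : ℕ → ℕ → ℕ → Carrier
  Jf zero h n = 0#
  Jf (suc f) h zero = 1#
  Jf (suc f) h (suc n) = cc h * Jf f h n + conv n
    where
    conv : ℕ → Carrier
    conv zero = 0#
    conv (suc m) = a h * sumTo (suc m) (λ i → Jf f (suc h) i * Jf f h (m ∸ i))

  J : ℕ → Series
  J h n = Jf (suc n) h n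

  K : ℕ → Series
  K zero = J 0
  K (suc s) = K s ⊛ zs (scale (a s) (J (suc s)))

  Scoeff : List ℕ → ℕ → Carrier
  Scoeff π l = sumL (map (λ λ′ → pow q (cr λ′) * pow p (ne λ′)) (Tset π l))

  u : List ℕ → ℕ → ℕ
  u π i = cr (piUp π i)

  v : List ℕ → ℕ → ℕ
  v π i = ne (piUp π i)

  sumN : List ℕ → ℕ
  sumN = foldr N._+_ 0

  b0 : List ℕ → ℕ → Carrier
  b0 π zero = pow q (u π 1) * pow p (v π 1)
  b0 π (suc r) =
    sumL (map (λ I → pow q (sumN (map (u π) I) ∸ r N.* u π 1)
                   * pow p (sumN (map (v π) I) ∸ r N.* v π 1))
              (choose (suc r) (map (2 N.+_) (upTo (nblocks π ∸ 1)))))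

  RHScoeff : List ℕ → ℕ → Carrier
  RHScoeff π l = sumTo (nblocks π) (λ s → b0 π s * K s l)

{-# OPTIONS --safe #-}
module Submission where

-- Putting a new letter in front of a word w either opens a new block, or joins the block of a letter x,
-- adding an arc that multiplies the weight by some step w x = q^i p^j.  Of the remaining blocks, the step
-- of those that start before x is then multiplied by q and of those that start after x by p, while the
-- block of the new letter gets step 1.  So the sum over the descendants of w depends only on the steps
-- 1, y₂, …, y_k of its blocks, and the recursion satisfied by its coefficients in the elementary symmetric
-- polynomials e_s(y₂, …, y_k) is the last-step recursion of weighted Motzkin paths from height 0 to
-- height s, which K_s satisfies.

open import Defs
open import Level using (Level)
open import Data.Bool using (Bool; true; false; T; _∧_; if_then_else_)
open import Data.Bool.Properties using (T-∧; T-≡; ∧-zeroʳ)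
open import Data.Nat using (ℕ; zero; suc; _∸_; _≤_; _<_; z≤n; s≤s; _≟_)
import Data.Nat as N
import Data.Nat.Properties as Nₚ
open import Data.Maybe using (Maybe; just; nothing)
import Data.Maybe as Maybe
open import Data.Maybe.Properties using (just-injective)
open import Data.Product using (∃; ∃₂; _×_; _,_; proj₁; proj₂)
open import Data.List using (List; []; _∷_; _++_; map; upTo; applyUpTo; length; concatMap; drop; filter; foldr)
open import Data.List.Properties
open import Data.List.Membership.Propositional using (_∈_)
open import Data.List.Membership.Propositional.Properties using (∈-filter⁺; ∈-filter⁻; ∈-upTo⁺)
open import Data.List.Relation.Unary.Any using (here; there)
open import Data.List.Relation.Unary.All using (All; []; _∷_)
import Data.List.Relation.Unary.All as All
import Data.List.Relation.Unary.All.Properties as Allₚ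
open import Data.List.Relation.Unary.AllPairs using (AllPairs; []; _∷_)
import Data.List.Relation.Unary.AllPairs as AllPairs
import Data.List.Relation.Unary.AllPairs.Properties as AllPairsₚ
open import Data.List.Relation.Unary.Unique.Propositional using (Unique)
open import Data.List.Relation.Unary.Unique.Propositional.Properties using (upTo⁺)
open import Data.List.Relation.Binary.Pointwise using (Pointwise; []; _∷_)
import Data.List.Relation.Binary.Pointwise as Pointwise
open import Algebra.Bundles using (CommutativeRing)
open import Algebra.Properties.CommutativeSemigroup Nₚ.+-commutativeSemigroup using (interchange)
open import Function using (_∘_; id; Equivalence; case_of_)
open import Relation.Nullary using (yes; no; contradiction)
open import Relation.Nullary.Decidable using (¬?; T?; dec-true; dec-false)
import Relation.Binary.PropositionalEquality as ≡
open ≡ using (_≡_; _≢_)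

-- Restricted growth strings are not stable under putting a letter in front: restoring the canonical
-- labelling may rename every letter. The induction therefore runs over arbitrary words, opens a
-- block with any absent letter, and compares words through `code`, which records only where each
-- letter occurs next; both `arcs` and `std` depend on that alone.
--
-- The constant `c_s = a_s + 1` comes from the step 1 of the leading block. Let `k_s` be the
-- coefficient of `K_s` in a fixed degree. Opening a block leaves all present steps unchanged and
-- contributes `k_s` to `e_s`; joining a block contributes `a_{s-1} k_{s-1}`. Both are sums over all
-- present blocks, that is, over the variables 1, y₂, ..., y_k, and
-- `e_s(1, y) = e_s(y) + e_{s-1}(y)`. So the coefficient of `e_s(y)` becomes `(k_s + a_{s-1}
-- k_{s-1}) + (k_{s+1} + a_s k_s)`, and collecting terms gives the path recursion `k_{s+1} + (a_s +
-- 1) k_s + a_{s-1} k_{s-1}`.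

module Words where

  open import Data.Nat using (_+_; _≤ᵇ_; _<ᵇ_; _≡ᵇ_; _<?_; _≤?_)
  open import Data.Nat.ListAction using (sum)
  open import Data.Nat.Properties hiding (_≟_; _<?_; _≤?_)
  open ≡

  -- First occurrences and block labels

  findIdx-here : ∀ x w → findIdx x (x ∷ w) ≡ just 0
  findIdx-here x w rewrite dec-true (x ≟ x) refl = refl

  findIdx-there : ∀ {x y} w → x ≢ y → findIdx x (y ∷ w) ≡ Maybe.map suc (findIdx x w)
  findIdx-there {x} {y} w x≢y rewrite dec-false (x ≟ y) x≢y = refl

  findIdx-zero : ∀ {x y} w → findIdx x (y ∷ w) ≡ just 0 → x ≡ y
  findIdx-zero {x} {y} w eq with x ≟ y
  ... | yes x≡y = x≡y
  ... | no x≢y rewrite dec-false (x ≟ y) x≢y with findIdx x w | eq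
  ...   | just _  | ()
  ...   | nothing | ()

  findIdx-suc : ∀ {x y i} w → findIdx x (y ∷ w) ≡ just (suc i) → x ≢ y × findIdx x w ≡ just i
  findIdx-suc {x} {y} w eq with x ≟ y
  ... | yes refl = case trans (sym (findIdx-here x w)) eq of λ ()
  ... | no x≢y rewrite dec-false (x ≟ y) x≢y with findIdx x w | eq
  ...   | just _ | refl = x≢y , refl

  findIdx-injective : ∀ {x y i} w → findIdx x w ≡ just i → findIdx y w ≡ just i → x ≡ y
  findIdx-injective {i = zero}  (z ∷ w) ex ey = trans (findIdx-zero w ex) (sym (findIdx-zero w ey))
  findIdx-injective {i = suc i} (z ∷ w) ex ey =
    findIdx-injective w (proj₂ (findIdx-suc w ex)) (proj₂ (findIdx-suc w ey))

  findIdx-< : ∀ {x i} w → findIdx x w ≡ just i → i < length w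
  findIdx-< {i = zero}  (y ∷ w) e = s≤s z≤n
  findIdx-< {i = suc i} (y ∷ w) e = s≤s (findIdx-< w (proj₂ (findIdx-suc w e)))

  fresh : List ℕ → ℕ
  fresh w = suc (sum w)

  findIdx-big : ∀ {x} w → sum w < x → findIdx x w ≡ nothing
  findIdx-big []      _ = refl
  findIdx-big (y ∷ w) s<x
    rewrite findIdx-there w (>⇒≢ (≤-<-trans (m≤m+n y (sum w)) s<x))
          | findIdx-big w (≤-<-trans (m≤n+m (sum w) y) s<x) = refl

  findIdx-fresh : ∀ w → findIdx (fresh w) w ≡ nothing
  findIdx-fresh w = findIdx-big w ≤-refl

  remove : ℕ → List ℕ → List ℕ
  remove x = filter (λ y → ¬? (x ≟ y))

  -- Letters are kept in order of first occurrence, so there is one entry per block and the blocks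
  -- come ordered by their minima.
  labels : List ℕ → List ℕ
  labels []      = []
  labels (x ∷ w) = x ∷ remove x (labels w)

  remove-here : ∀ x ys → remove x (x ∷ ys) ≡ remove x ys
  remove-here x ys = filter-reject (λ y → ¬? (x ≟ y)) (λ x≢x → x≢x refl)

  remove-there : ∀ {x y} ys → x ≢ y → remove x (y ∷ ys) ≡ y ∷ remove x ys
  remove-there {x} ys = filter-accept (λ y → ¬? (x ≟ y))

  remove-absent : ∀ {x ys} → All (x ≢_) ys → remove x ys ≡ ys
  remove-absent {x} = filter-all (λ y → ¬? (x ≟ y))

  ∈-labels⁺ : ∀ {x i} w → findIdx x w ≡ just i → x ∈ labels w
  ∈-labels⁺ {i = zero}  (y ∷ w) e = here (findIdx-zero w e)
  ∈-labels⁺ {x} {suc i} (y ∷ w) e with findIdx-suc w e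
  ... | x≢y , e′ = there (∈-filter⁺ (λ z → ¬? (y ≟ z)) (∈-labels⁺ w e′) (x≢y ∘ sym))

  ∈-labels⁻ : ∀ {x} w → x ∈ labels w → ∃ λ i → findIdx x w ≡ just i
  ∈-labels⁻ (y ∷ w) (here refl) = 0 , findIdx-here y w
  ∈-labels⁻ (y ∷ w) (there x∈) with ∈-filter⁻ (λ z → ¬? (y ≟ z)) {xs = labels w} x∈
  ... | x∈w , y≢x with ∈-labels⁻ w x∈w
  ...   | i , e = suc i , trans (findIdx-there w (y≢x ∘ sym)) (cong (Maybe.map suc) e)

  Before : List ℕ → ℕ → ℕ → Set
  Before w x y = ∃₂ λ i j → findIdx x w ≡ just i × findIdx y w ≡ just j × i < j

  Before⇒≢ : ∀ w {x y} → Before w x y → x ≢ y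
  Before⇒≢ w (i , j , ex , ey , i<j) refl = <⇒≢ i<j (just-injective (trans (sym ex) ey))

  Before-∷ : ∀ w {x y z} → z ≢ x → z ≢ y → Before w x y → Before (z ∷ w) x y
  Before-∷ w z≢x z≢y (i , j , ex , ey , i<j) =
    suc i , suc j , trans (findIdx-there w (z≢x ∘ sym)) (cong (Maybe.map suc) ex)
    , trans (findIdx-there w (z≢y ∘ sym)) (cong (Maybe.map suc) ey) , s≤s i<j

  private
    AllPairs-map-All : ∀ {P : ℕ → Set} {R S : ℕ → ℕ → Set} → (∀ {x y} → P x → P y → R x y → S x y) →
                       ∀ {xs} → All P xs → AllPairs R xs → AllPairs S xs
    AllPairs-map-All f [] [] = []
    AllPairs-map-All f (px ∷ pxs) (rx ∷ rxs) =
      All.zipWith (λ (py , r) → f px py r) (pxs , rx) ∷ AllPairs-map-All f pxs rxs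

  labels-sorted : ∀ w → AllPairs (Before w) (labels w)
  labels-sorted []      = []
  labels-sorted (x ∷ w) =
    All.tabulate first ∷
    AllPairs-map-All (Before-∷ w) (Allₚ.all-filter (λ y → ¬? (x ≟ y)) (labels w))
                     (AllPairsₚ.filter⁺ (λ y → ¬? (x ≟ y)) (labels-sorted w))
    where
    first : ∀ {y} → y ∈ remove x (labels w) → Before (x ∷ w) x y
    first y∈ with ∈-filter⁻ (λ z → ¬? (x ≟ z)) {xs = labels w} y∈
    ... | y∈w , x≢y with ∈-labels⁻ w y∈w
    ...   | i , e = 0 , suc i , findIdx-here x w
                  , trans (findIdx-there w (x≢y ∘ sym)) (cong (Maybe.map suc) e) , s≤s z≤n

  -- Arcs

  shift : ℕ × ℕ → ℕ × ℕ
  shift a = suc (proj₁ a) , suc (proj₂ a)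

  private variable A B : Set

  count-∷ : ∀ (f : A → Bool) x xs → count f (x ∷ xs) ≡ (if f x then 1 else 0) + count f xs
  count-∷ f x xs with f x
  ... | true  = refl
  ... | false = refl

  count-++ : ∀ (f : A → Bool) xs ys → count f (xs ++ ys) ≡ count f xs + count f ys
  count-++ f xs ys = trans (cong length (filter-++ (T? ∘ f) xs ys)) (length-++ (filter (T? ∘ f) xs))

  count-map : ∀ (f : B → Bool) (g : A → B) xs → count f (map g xs) ≡ count (f ∘ g) xs
  count-map f g [] = refl
  count-map f g (x ∷ xs)
    rewrite count-∷ f (g x) (map g xs) | count-∷ (f ∘ g) x xs | count-map f g xs = refl

  count-none : ∀ (f : A → Bool) → (∀ x → f x ≡ false) → ∀ xs → count f xs ≡ 0
  count-none f none []       = refl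
  count-none f none (x ∷ xs) rewrite count-∷ f x xs | none x = count-none f none xs

  count-concatMap : ∀ (f : B → Bool) (g : ℕ × ℕ → A) (h : A → List B) (h′ : ℕ × ℕ → List B)
                    (f′ : B → Bool) → (∀ x → count f (h (g x)) ≡ count f′ (h′ x)) →
                    ∀ xs → count f (concatMap h (map g xs)) ≡ count f′ (concatMap h′ xs)
  count-concatMap f g h h′ f′ eq [] = refl
  count-concatMap f g h h′ f′ eq (x ∷ xs) = begin
    count f (h (g x) ++ concatMap h (map g xs))
      ≡⟨ count-++ f (h (g x)) _ ⟩
    count f (h (g x)) + count f (concatMap h (map g xs))
      ≡⟨ cong₂ _+_ (eq x) (count-concatMap f g h h′ f′ eq xs) ⟩
    count f′ (h′ x) + count f′ (concatMap h′ xs)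
      ≡⟨ count-++ f′ (h′ x) _ ⟨
    count f′ (h′ x ++ concatMap h′ xs) ∎
    where open ≡-Reasoning

  module _ (f : (ℕ × ℕ) × (ℕ × ℕ) → Bool)
           (f-shift : ∀ b c → f (shift b , shift c) ≡ f (b , c)) where

    count-row-shift : ∀ b xs → count f (map (λ c → shift b , c) (map shift xs)) ≡ count f (map (λ c → b , c) xs)
    count-row-shift b [] = refl
    count-row-shift b (c ∷ xs)
      rewrite count-∷ f (shift b , shift c) (map (λ c → shift b , c) (map shift xs))
            | count-∷ f (b , c) (map (λ c → b , c) xs) | f-shift b c | count-row-shift b xs = refl

    count-pairs-shift : ∀ xs → count f (pairs (map shift xs)) ≡ count f (pairs xs)
    count-pairs-shift xs = count-concatMap f shift _ _ f (λ b → count-row-shift b xs) xs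

    module _ (f-start : ∀ b j → f (shift b , (0 , j)) ≡ false) (f-self : ∀ j → f ((0 , j) , (0 , j)) ≡ false) where

      -- In a crossing or nesting the first arc starts strictly to the left of the second, so an arc
      -- starting at 0 can only be the first member. The new pairs are then counted by one sweep
      -- over the old arcs.
      count-pairs-∷ : ∀ j xs → count f (pairs ((0 , j) ∷ map shift xs))
                             ≡ count f (pairs xs) + count (λ b → f ((0 , j) , shift b)) xs
      count-pairs-∷ j xs = begin
        count f (map (a ,_) (a ∷ ys) ++ concatMap row ys)
          ≡⟨ count-++ f (map (a ,_) (a ∷ ys)) _ ⟩
        count f (map (a ,_) (a ∷ ys)) + count f (concatMap row ys)
          ≡⟨ cong₂ _+_ first (count-concatMap f shift row _ f rest xs) ⟩
        count (λ b → f (a , shift b)) xs + count f (pairs xs)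
          ≡⟨ +-comm _ (count f (pairs xs)) ⟩
        count f (pairs xs) + count (λ b → f (a , shift b)) xs ∎
        where
        open ≡-Reasoning
        a : ℕ × ℕ
        a = 0 , j
        ys : List (ℕ × ℕ)
        ys = map shift xs
        row : ℕ × ℕ → List ((ℕ × ℕ) × (ℕ × ℕ))
        row b = map (b ,_) (a ∷ ys)
        first : count f (map (a ,_) (a ∷ ys)) ≡ count (λ b → f (a , shift b)) xs
        first rewrite count-∷ f (a , a) (map (a ,_) ys) | f-self j =
          trans (count-map f (a ,_) ys) (count-map (f ∘ (a ,_)) shift xs)
        rest : ∀ b → count f (row (shift b)) ≡ count f (map (b ,_) xs)
        rest b rewrite count-∷ f (shift b , a) (map (shift b ,_) ys) | f-start b j = count-row-shift b xs

  -- The crossings (nestings) that an arc into position m adds to a word when a letter is put in front.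
  newCr newNe : Maybe ℕ → List (ℕ × ℕ) → ℕ
  newCr nothing  as = 0
  newCr (just m) as = count (λ (i , j) → (i <ᵇ m) ∧ (m <ᵇ j)) as
  newNe nothing  as = 0
  newNe (just m) as = count (λ (i , j) → (i <ᵇ j) ∧ (j <ᵇ m)) as

  cr-∷ : ∀ x w → cr (x ∷ w) ≡ cr w + newCr (findIdx x w) (arcs w)
  cr-∷ x w with findIdx x w
  ... | just m  = count-pairs-∷ isCrossing (λ _ _ → refl) (λ _ _ → refl) (λ _ → refl) (suc m) (arcs w)
  ... | nothing = trans (count-pairs-shift isCrossing (λ _ _ → refl) (arcs w)) (sym (+-identityʳ (cr w)))

  ne-∷ : ∀ x w → ne (x ∷ w) ≡ ne w + newNe (findIdx x w) (arcs w)
  ne-∷ x w with findIdx x w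
  ... | just m  = count-pairs-∷ isNesting (λ _ _ → refl) (λ _ _ → refl) (λ _ → refl) (suc m) (arcs w)
  ... | nothing = trans (count-pairs-shift isNesting (λ _ _ → refl) (arcs w)) (sym (+-identityʳ (ne w)))

  newCr-zero : ∀ as → newCr (just 0) as ≡ 0
  newCr-zero = count-none _ (λ _ → refl)

  newNe-zero : ∀ as → newNe (just 0) as ≡ 0
  newNe-zero = count-none _ λ (i , j) → ∧-false (i <ᵇ j)
    where
    ∧-false : ∀ b → b ∧ false ≡ false
    ∧-false true  = refl
    ∧-false false = refl

  newCr-shift : ∀ m as → newCr (just (suc m)) (map shift as) ≡ newCr (just m) as
  newCr-shift m as = count-map _ shift as

  newNe-shift : ∀ m as → newNe (just (suc m)) (map shift as) ≡ newNe (just m) as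
  newNe-shift m as = count-map _ shift as

  module _ {w x m} (ex : findIdx x w ≡ just m) where

    newCr-fresh : ∀ {y} → findIdx y w ≡ nothing → newCr (just (suc m)) (arcs (y ∷ w)) ≡ newCr (findIdx x w) (arcs w)
    newCr-fresh {y} ey rewrite ey | ex = newCr-shift m (arcs w)

    newNe-fresh : ∀ {y} → findIdx y w ≡ nothing → newNe (just (suc m)) (arcs (y ∷ w)) ≡ newNe (findIdx x w) (arcs w)
    newNe-fresh {y} ey rewrite ey | ex = newNe-shift m (arcs w)

    -- The arc of `y` runs from 0 to `suc j` and passes over the first `x`, at `suc m`; an arc drawn
    -- into that `x` from further left crosses it.
    newCr-after : ∀ {y j} → findIdx y w ≡ just j → m < j →
                  newCr (just (suc m)) (arcs (y ∷ w)) ≡ suc (newCr (findIdx x w) (arcs w))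
    newCr-after {y} {j} ey m<j
      rewrite ey | ex
            | count-∷ (λ (i , k) → (i <ᵇ suc m) ∧ (suc m <ᵇ k)) (0 , suc j) (map shift (arcs w))
            | dec-true (m <? j) m<j = cong suc (newCr-shift m (arcs w))

    newNe-after : ∀ {y j} → findIdx y w ≡ just j → m < j →
                  newNe (just (suc m)) (arcs (y ∷ w)) ≡ newNe (findIdx x w) (arcs w)
    newNe-after {y} {j} ey m<j
      rewrite ey | ex
            | count-∷ (λ (i , k) → (i <ᵇ k) ∧ (k <ᵇ suc m)) (0 , suc j) (map shift (arcs w))
            | dec-false (j <? m) (<⇒≯ m<j) = newNe-shift m (arcs w)

    newCr-before : ∀ {y j} → findIdx y w ≡ just j → j < m →
                   newCr (just (suc m)) (arcs (y ∷ w)) ≡ newCr (findIdx x w) (arcs w)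
    newCr-before {y} {j} ey j<m
      rewrite ey | ex
            | count-∷ (λ (i , k) → (i <ᵇ suc m) ∧ (suc m <ᵇ k)) (0 , suc j) (map shift (arcs w))
            | dec-false (m <? j) (<⇒≯ j<m) = newCr-shift m (arcs w)

    -- The arc of `y` ends before the first `x`, so an arc drawn into that `x` from further left
    -- covers it.
    newNe-before : ∀ {y j} → findIdx y w ≡ just j → j < m →
                   newNe (just (suc m)) (arcs (y ∷ w)) ≡ suc (newNe (findIdx x w) (arcs w))
    newNe-before {y} {j} ey j<m
      rewrite ey | ex
            | count-∷ (λ (i , k) → (i <ᵇ k) ∧ (k <ᵇ suc m)) (0 , suc j) (map shift (arcs w))
            | dec-true (j <? m) j<m = cong suc (newNe-shift m (arcs w))

  -- Words up to renaming of letters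

  -- Two words describe the same set partition iff their codes agree.
  code : List ℕ → List (Maybe ℕ)
  code []      = []
  code (x ∷ w) = findIdx x w ∷ code w

  findIdx-++ : ∀ {x i} ys zs → findIdx x ys ≡ just i → findIdx x (ys ++ zs) ≡ just i
  findIdx-++ {i = zero}  (y ∷ ys) zs e with refl ← findIdx-zero ys e = findIdx-here y (ys ++ zs)
  findIdx-++ {i = suc i} (y ∷ ys) zs e with findIdx-suc ys e
  ... | x≢y , e′ = trans (findIdx-there (ys ++ zs) x≢y) (cong (Maybe.map suc) (findIdx-++ ys zs e′))

  findIdx-∷ʳ : ∀ {x} ys → findIdx x ys ≡ nothing → findIdx x (ys ++ x ∷ []) ≡ just (length ys)
  findIdx-∷ʳ {x} []       e = findIdx-here x []
  findIdx-∷ʳ {x} (y ∷ ys) e with x ≟ y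
  ... | yes refl = case trans (sym (findIdx-here x ys)) e of λ ()
  ... | no x≢y = trans (findIdx-there (ys ++ x ∷ []) x≢y) (cong (Maybe.map suc) (findIdx-∷ʳ ys absent))
    where
    absent : findIdx x ys ≡ nothing
    absent with findIdx x ys | trans (sym (findIdx-there ys x≢y)) e
    ... | nothing | _ = refl

  -- Only `x` can be renamed `i`: another letter of `seen` has another index by `findIdx-injective`,
  -- and a letter not yet seen is named by the length of the list, which exceeds `i`.
  findIdx-std′ : ∀ {x i} seen w → findIdx x seen ≡ just i → findIdx i (std′ seen w) ≡ findIdx x w
  findIdx-std′ seen [] e = refl
  findIdx-std′ {x} {i} seen (y ∷ w) e with findIdx y seen in ey
  ... | just j with x ≟ y
  ...   | yes refl with refl ← just-injective (trans (sym e) ey) =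
          trans (findIdx-here j (std′ seen w)) (sym (findIdx-here x w))
  ...   | no x≢y =
          trans (findIdx-there (std′ seen w) λ { refl → x≢y (findIdx-injective seen e ey) })
                (trans (cong (Maybe.map suc) (findIdx-std′ seen w e)) (sym (findIdx-there w x≢y)))
  findIdx-std′ {x} {i} seen (y ∷ w) e | nothing =
    trans (findIdx-there (std′ (seen ++ y ∷ []) w) (<⇒≢ (findIdx-< seen e)))
          (trans (cong (Maybe.map suc) (findIdx-std′ (seen ++ y ∷ []) w (findIdx-++ seen (y ∷ []) e)))
                 (sym (findIdx-there w λ { refl → case trans (sym e) ey of λ () })))

  code-std′ : ∀ seen w → code (std′ seen w) ≡ code w
  code-std′ seen [] = refl
  code-std′ seen (x ∷ w) with findIdx x seen in ex
  ... | just i  = cong₂ _∷_ (findIdx-std′ seen w ex) (code-std′ seen w)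
  ... | nothing = cong₂ _∷_ (findIdx-std′ (seen ++ x ∷ []) w (findIdx-∷ʳ seen ex)) (code-std′ (seen ++ x ∷ []) w)

  -- The invariant between the two `seen` lists in `std′-cong`: letters with the same index must
  -- recur at the same place in what remains of the two words, or in neither.
  SameNext : List ℕ → List ℕ → ℕ → ℕ → Set
  SameNext w w′ x x′ = findIdx x w ≡ findIdx x′ w′

  -- If `z` is the letter just read, then so is `z′`, and the next recurrence is the head of the two
  -- codes; otherwise both positions drop by one.
  SameNext-tail : ∀ {x x′} w w′ {z z′} → findIdx x w ≡ findIdx x′ w′ →
                  SameNext (x ∷ w) (x′ ∷ w′) z z′ → SameNext w w′ z z′
  SameNext-tail {x} {x′} w w′ {z} {z′} same e with z ≟ x
  ... | yes refl with refl ← findIdx-zero w′ (trans (sym e) (findIdx-here x w)) = same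
  ... | no z≢x with z′ ≟ x′
  ...   | yes refl = contradiction (findIdx-zero w (trans e (findIdx-here x′ w′))) z≢x
  ...   | no z′≢x′ with findIdx z w | findIdx z′ w′
                     | trans (sym (findIdx-there w z≢x)) (trans e (findIdx-there w′ z′≢x′))
  ...     | just _  | just _  | refl = refl
  ...     | nothing | nothing | _    = refl

  -- The front letter of a word is the only one that recurs at position 0, so the invariant finds it
  -- at the same index in both lists.
  findIdx-SameNext : ∀ {x x′} w w′ {seen seen′} → Pointwise (SameNext (x ∷ w) (x′ ∷ w′)) seen seen′ →
                     findIdx x seen ≡ findIdx x′ seen′
  findIdx-SameNext w w′ [] = refl
  findIdx-SameNext {x} {x′} w w′ {y ∷ seen} {y′ ∷ seen′} (e ∷ es) with x ≟ y | x′ ≟ y′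
  ... | yes refl | yes refl = trans (findIdx-here x seen) (sym (findIdx-here x′ seen′))
  ... | no x≢y   | no x′≢y′ = trans (findIdx-there seen x≢y)
                                (trans (cong (Maybe.map suc) (findIdx-SameNext w w′ es)) (sym (findIdx-there seen′ x′≢y′)))
  ... | yes refl | no x′≢y′ = contradiction (sym (findIdx-zero w′ (trans (sym e) (findIdx-here x w)))) x′≢y′
  ... | no x≢y   | yes refl = contradiction (sym (findIdx-zero w (trans e (findIdx-here x′ w′)))) x≢y

  std′-cong : ∀ {seen seen′} w w′ → code w ≡ code w′ → Pointwise (SameNext w w′) seen seen′ →
              std′ seen w ≡ std′ seen′ w′
  std′-cong [] [] e es = refl
  std′-cong {seen} {seen′} (x ∷ w) (x′ ∷ w′) e es
    with findIdx x seen | findIdx x′ seen′ | findIdx-SameNext w w′ es | ∷-injective e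
  ... | just i  | just _  | refl | same , e′ =
    cong (i ∷_) (std′-cong w w′ e′ (Pointwise.map (SameNext-tail w w′ same) es))
  ... | nothing | nothing | _ | same , e′ =
    cong₂ _∷_ (Pointwise.Pointwise-length es)
      (std′-cong w w′ e′ (Pointwise.++⁺ (Pointwise.map (SameNext-tail w w′ same) es) (same ∷ [])))

  std-cong : ∀ w w′ → code w ≡ code w′ → std w ≡ std w′
  std-cong w w′ e = std′-cong w w′ e []

  std-injective : ∀ w w′ → std w ≡ std w′ → code w ≡ code w′
  std-injective w w′ e = trans (sym (code-std′ [] w)) (trans (cong code e) (code-std′ [] w′))

  code-arcs : ∀ w w′ → code w ≡ code w′ → arcs w ≡ arcs w′
  code-arcs [] [] e = refl
  code-arcs (x ∷ w) (x′ ∷ w′) e with ∷-injective e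
  ... | same , e′ rewrite same | code-arcs w w′ e′ = refl

  findIdx-transfer : ∀ {x i} w w′ → code w ≡ code w′ → findIdx x w ≡ just i → ∃ λ x′ → findIdx x′ w′ ≡ just i
  findIdx-transfer {i = zero}  (z ∷ w) (z′ ∷ w′) e ex = z′ , findIdx-here z′ w′
  findIdx-transfer {x} {suc i} (z ∷ w) (z′ ∷ w′) e ex with ∷-injective e | findIdx-suc w ex
  ... | same , e′ | x≢z , ex′ with findIdx-transfer w w′ e′ ex′
  ...   | x′ , ex″ = x′ , trans (findIdx-there w′ x′≢z′) (cong (Maybe.map suc) ex″)
    where
    x′≢z′ : x′ ≢ z′
    x′≢z′ refl = x≢z (findIdx-injective w ex′ (trans same ex″))

  -- Restricted growth strings

  -- The last field is the value of the test on which `rgsOk` and `blocksFrom` branch, kept for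
  -- rewriting.
  data RGSView (m : ℕ) (x : ℕ) (w : List ℕ) : Set where
    old : x < m → T (rgsOk m w) → (x ≡ᵇ m) ≡ false → RGSView m x w
    new : x ≡ m → T (rgsOk (suc m) w) → (x ≡ᵇ m) ≡ true → RGSView m x w

  rgsView : ∀ m x w → T (rgsOk m (x ∷ w)) → RGSView m x w
  rgsView m x w ok with Equivalence.to (T-∧ {x ≤ᵇ m}) ok | x ≟ m
  ... | x≤m , okw | yes x≡m =
    new x≡m (subst (λ b → T (rgsOk (if b then suc m else m) w)) (dec-true (x ≟ m) x≡m) okw) (dec-true (x ≟ m) x≡m)
  ... | x≤m , okw | no x≢m =
    old (≤∧≢⇒< (≤ᵇ⇒≤ x m x≤m) x≢m)
        (subst (λ b → T (rgsOk (if b then suc m else m) w)) (dec-false (x ≟ m) x≢m) okw) (dec-false (x ≟ m) x≢m)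

  findIdx-applyUpTo-∉ : ∀ {x} (f : ℕ → ℕ) m → (∀ i → i < m → f i ≢ x) → findIdx x (applyUpTo f m) ≡ nothing
  findIdx-applyUpTo-∉ f zero    f≢x = refl
  findIdx-applyUpTo-∉ f (suc m) f≢x =
    trans (findIdx-there (applyUpTo (f ∘ suc) m) (f≢x 0 (s≤s z≤n) ∘ sym))
          (cong (Maybe.map suc) (findIdx-applyUpTo-∉ (f ∘ suc) m (λ i i<m → f≢x (suc i) (s≤s i<m))))

  findIdx-applyUpTo : ∀ {i} (f : ℕ → ℕ) m → (∀ {j k} → f j ≡ f k → j ≡ k) → i < m →
                      findIdx (f i) (applyUpTo f m) ≡ just i
  findIdx-applyUpTo {zero}  f (suc m) f-inj i<m = findIdx-here (f 0) (applyUpTo (f ∘ suc) m)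
  findIdx-applyUpTo {suc i} f (suc m) f-inj (s≤s i<m) =
    trans (findIdx-there (applyUpTo (f ∘ suc) m) (λ e → case f-inj e of λ ()))
          (cong (Maybe.map suc) (findIdx-applyUpTo (f ∘ suc) m (suc-injective ∘ f-inj) i<m))

  -- In `upTo m` every letter is its own index and the next name is `m`, exactly the new letter that
  -- restricted growth allows.
  std′-rgs : ∀ m w → T (rgsOk m w) → std′ (upTo m) w ≡ w
  std′-rgs m [] ok = refl
  std′-rgs m (x ∷ w) ok with rgsView m x w ok
  ... | old x<m okw _ rewrite findIdx-applyUpTo id m id x<m = cong (x ∷_) (std′-rgs m w okw)
  ... | new refl okw _
    rewrite findIdx-applyUpTo-∉ {m} id m (λ _ → <⇒≢) | length-upTo m | upTo-∷ʳ m =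
    cong (m ∷_) (std′-rgs (suc m) w okw)

  std-rgs : ∀ w → T (isRGS w) → std w ≡ w
  std-rgs = std′-rgs 0

  rgs-std′ : ∀ seen w → T (rgsOk (length seen) (std′ seen w))
  rgs-std′ seen [] = _
  rgs-std′ seen (x ∷ w) with findIdx x seen in e
  ... | just i rewrite dec-false (i ≟ length seen) (<⇒≢ (findIdx-< seen e)) =
    Equivalence.from T-∧ (≤⇒≤ᵇ (<⇒≤ (findIdx-< seen e)) , rgs-std′ seen w)
  ... | nothing rewrite dec-true (length seen ≟ length seen) refl =
    Equivalence.from T-∧ (≤⇒≤ᵇ (≤-refl {length seen}) ,
      subst (λ m → T (rgsOk m (std′ (seen ++ x ∷ []) w)))
            (trans (length-++ seen) (+-comm (length seen) 1)) (rgs-std′ (seen ++ x ∷ []) w))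

  length-std′ : ∀ seen w → length (std′ seen w) ≡ length w
  length-std′ seen [] = refl
  length-std′ seen (x ∷ w) with findIdx x seen
  ... | just i  = cong suc (length-std′ seen w)
  ... | nothing = cong suc (length-std′ (seen ++ x ∷ []) w)

  -- Each position opens at most one block. For `m = 0` the alphabet of `words M M` is thus large
  -- enough for every restricted growth string of length `M`.
  rgs-bounded : ∀ m w → T (rgsOk m w) → All (_< m + length w) w
  rgs-bounded m [] ok = []
  rgs-bounded m (x ∷ w) ok rewrite +-suc m (length w) with rgsView m x w ok
  ... | old x<m okw _ = m≤n⇒m≤1+n (≤-trans x<m (m≤m+n m (length w))) ∷ All.map m<n⇒m<1+n (rgs-bounded m w okw)
  ... | new refl okw _ = s≤s (m≤m+n m (length w)) ∷ rgs-bounded (suc m) w okw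

  remove-below : ∀ {m x} ys → x < m → filter (m ≤?_) (remove x ys) ≡ filter (m ≤?_) ys
  remove-below [] x<m = refl
  remove-below {m} {x} (y ∷ ys) x<m with x ≟ y
  ... | yes refl rewrite remove-here x ys | filter-reject (m ≤?_) {x} {ys} (<⇒≱ x<m) = remove-below ys x<m
  ... | no x≢y rewrite remove-there ys x≢y with m ≤? y
  ...   | yes m≤y rewrite filter-accept (m ≤?_) {y} {remove x ys} m≤y | filter-accept (m ≤?_) {y} {ys} m≤y =
            cong (y ∷_) (remove-below ys x<m)
  ...   | no m≰y rewrite filter-reject (m ≤?_) {y} {remove x ys} m≰y | filter-reject (m ≤?_) {y} {ys} m≰y =
            remove-below ys x<m

  remove-least : ∀ m ys → filter (m ≤?_) (remove m ys) ≡ filter (suc m ≤?_) ys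
  remove-least m [] = refl
  remove-least m (y ∷ ys) with m ≟ y
  ... | yes refl rewrite remove-here m ys | filter-reject (suc m ≤?_) {m} {ys} (<⇒≱ ≤-refl) = remove-least m ys
  ... | no m≢y rewrite remove-there ys m≢y with m ≤? y
  ...   | yes m≤y rewrite filter-accept (m ≤?_) {y} {remove m ys} m≤y
                        | filter-accept (suc m ≤?_) {y} {ys} (≤∧≢⇒< m≤y m≢y) = cong (y ∷_) (remove-least m ys)
  ...   | no m≰y rewrite filter-reject (m ≤?_) {y} {remove m ys} m≰y
                       | filter-reject (suc m ≤?_) {y} {ys} (m≰y ∘ <⇒≤) = remove-least m ys

  -- A suffix of a restricted growth string may repeat old letters in any order; only those from `m`
  -- on must first appear in increasing order. Filtering out the old ones makes the induction close,
  -- and for `m = 0` nothing is filtered.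
  new-labels-rgs : ∀ m w → T (rgsOk m w) →
                   ∃ λ n → blocksFrom m w ≡ m + n × filter (m ≤?_) (labels w) ≡ applyUpTo (m +_) n
  new-labels-rgs m [] ok = 0 , sym (+-identityʳ m) , refl
  new-labels-rgs m (x ∷ w) ok with rgsView m x w ok
  ... | old x<m okw x≢m rewrite x≢m | filter-reject (m ≤?_) {x} {remove x (labels w)} (<⇒≱ x<m)
                              | remove-below (labels w) x<m = new-labels-rgs m w okw
  ... | new refl okw x≡m
    rewrite x≡m | filter-accept (m ≤?_) {m} {remove m (labels w)} ≤-refl | remove-least m (labels w)
    with new-labels-rgs (suc m) w okw
  ...   | n , blocks , labs = suc n , trans blocks (sym (+-suc m n)) ,
          cong₂ _∷_ (sym (+-identityʳ m))
            (trans labs (applyUpTo-cong n (λ i → sym (+-suc m i))))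
    where
    applyUpTo-cong : ∀ {f g : ℕ → ℕ} n → (∀ i → f i ≡ g i) → applyUpTo f n ≡ applyUpTo g n
    applyUpTo-cong zero    e = refl
    applyUpTo-cong (suc n) e = cong₂ _∷_ (e 0) (applyUpTo-cong n (e ∘ suc))

  labels-rgs : ∀ w → T (isRGS w) → labels w ≡ upTo (nblocks w)
  labels-rgs w ok with new-labels-rgs 0 w ok
  ... | n , blocks , labs =
    trans (sym (filter-all (0 ≤?_) (All.universal (λ _ → z≤n) (labels w)))) (trans labs (cong upTo (sym blocks)))

  -- Equality tests and enumerated words

  eqList-refl : ∀ xs → eqList xs xs ≡ true
  eqList-refl []       = refl
  eqList-refl (x ∷ xs) rewrite Equivalence.to T-≡ (≡⇒≡ᵇ x x refl) = eqList-refl xs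

  eqList-≢ : ∀ xs ys → xs ≢ ys → eqList xs ys ≡ false
  eqList-≢ xs ys xs≢ys with eqList xs ys in e
  ... | false = refl
  ... | true  = contradiction (sound xs ys e) xs≢ys
    where
    sound : ∀ xs ys → eqList xs ys ≡ true → xs ≡ ys
    sound []       []       e = refl
    sound (x ∷ xs) (y ∷ ys) e with x ≡ᵇ y in x≡ᵇy
    ... | true = cong₂ _∷_ (≡ᵇ⇒≡ x y (Equivalence.from T-≡ x≡ᵇy)) (sound xs ys e)

  drop-split : ∀ l (v : List ℕ) → l < length v → ∃₂ λ y ys → drop l v ≡ y ∷ ys × drop (suc l) v ≡ ys
  drop-split zero    (x ∷ v) _         = x , v , refl , refl
  drop-split (suc l) (x ∷ v) (s≤s l<v) = drop-split l v l<v

  words-length : ∀ A n → All (λ v → length v ≡ n) (words A n)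
  words-length A zero    = refl ∷ []
  words-length A (suc n) = Allₚ.concat⁺ (Allₚ.map⁺ (All.universal
    (λ x → Allₚ.map⁺ (All.map (cong suc) (words-length A n))) (upTo A)))

  choose-length : ∀ {A : Set} r (xs : List A) → All (λ I → length I ≡ r) (choose r xs)
  choose-length zero    xs       = refl ∷ []
  choose-length (suc r) []       = []
  choose-length (suc r) (x ∷ xs) =
    Allₚ.++⁺ (Allₚ.map⁺ (All.map (cong suc) (choose-length r xs))) (choose-length (suc r) xs)

  -- Letters representing the children of a word

  childLetters : List ℕ → List ℕ
  childLetters w = fresh w ∷ labels w

  fresh∉labels : ∀ w → All (fresh w ≢_) (labels w)
  fresh∉labels w = All.tabulate λ { x∈ refl → case trans (sym (findIdx-fresh w)) (proj₂ (∈-labels⁻ w x∈)) of λ () }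

  labels-unique : ∀ w → Unique (labels w)
  labels-unique w = AllPairs.map (Before⇒≢ w) (labels-sorted w)

  childLetters-unique : ∀ w → Unique (childLetters w)
  childLetters-unique w = fresh∉labels w ∷ labels-unique w

  childLetters-injective : ∀ w {x y} → x ∈ childLetters w → y ∈ childLetters w → findIdx x w ≡ findIdx y w → x ≡ y
  childLetters-injective w (here refl) (here refl) e = refl
  childLetters-injective w (here refl) (there y∈) e =
    case trans (sym (findIdx-fresh w)) (trans e (proj₂ (∈-labels⁻ w y∈))) of λ ()
  childLetters-injective w (there x∈) (here refl) e =
    case trans (sym (findIdx-fresh w)) (trans (sym e) (proj₂ (∈-labels⁻ w x∈))) of λ ()
  childLetters-injective w (there x∈) (there y∈) e with ∈-labels⁻ w x∈
  ... | i , ex = findIdx-injective w ex (trans (sym e) ex)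

  -- Together with `childLetters-injective` this makes `childLetters w` a system of representatives
  -- for the ways to extend the partition of `w` by one element.
  child-exists : ∀ {y} ys w → code ys ≡ code w → ∃ λ x → x ∈ childLetters w × findIdx y ys ≡ findIdx x w
  child-exists {y} ys w e with findIdx y ys in ey
  ... | nothing = fresh w , here refl , sym (findIdx-fresh w)
  ... | just i with findIdx-transfer ys w e ey
  ...   | x , ex = x , there (∈-labels⁺ w ex) , sym ex

open Words

module Tree {c ℓ : Level} (R : CommutativeRing c ℓ) (q p : CommutativeRing.Carrier R) where
  open CommutativeRing R
  open Series R q p
  open import Algebra.Solver.Ring.NaturalCoefficients.Default commutativeSemiring
    using (solve; _:=_; _:+_; _:*_; con)
  open import Relation.Binary.Reasoning.Setoid setoid

  -- Finite sums

  Σ∈ : {A : Set} → List A → (A → Carrier) → Carrier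
  Σ∈ xs f = sumL (map f xs)

  module _ {A : Set} where

    Σ∈-cong : ∀ {f g : A → Carrier} xs → (∀ x → f x ≈ g x) → Σ∈ xs f ≈ Σ∈ xs g
    Σ∈-cong []       e = refl
    Σ∈-cong (x ∷ xs) e = +-cong (e x) (Σ∈-cong xs e)

    Σ∈-+ : ∀ (f g : A → Carrier) xs → Σ∈ xs (λ x → f x + g x) ≈ Σ∈ xs f + Σ∈ xs g
    Σ∈-+ f g []       = sym (+-identityˡ 0#)
    Σ∈-+ f g (x ∷ xs) = begin
      f x + g x + Σ∈ xs (λ x → f x + g x)   ≈⟨ +-congˡ (Σ∈-+ f g xs) ⟩
      f x + g x + (Σ∈ xs f + Σ∈ xs g)
        ≈⟨ solve 4 (λ a b c d → a :+ b :+ (c :+ d) := a :+ c :+ (b :+ d)) refl (f x) (g x) (Σ∈ xs f) (Σ∈ xs g) ⟩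
      f x + Σ∈ xs f + (g x + Σ∈ xs g)       ∎

    Σ∈-*ˡ : ∀ y (f : A → Carrier) xs → Σ∈ xs (λ x → y * f x) ≈ y * Σ∈ xs f
    Σ∈-*ˡ y f []       = sym (zeroʳ y)
    Σ∈-*ˡ y f (x ∷ xs) = trans (+-congˡ (Σ∈-*ˡ y f xs)) (sym (distribˡ y (f x) (Σ∈ xs f)))

    Σ∈-zero : ∀ (f : A → Carrier) xs → (∀ x → f x ≈ 0#) → Σ∈ xs f ≈ 0#
    Σ∈-zero f []       z = refl
    Σ∈-zero f (x ∷ xs) z = trans (+-cong (z x) (Σ∈-zero f xs z)) (+-identityˡ 0#)

    Σ∈-++ : ∀ (f : A → Carrier) xs ys → Σ∈ (xs ++ ys) f ≈ Σ∈ xs f + Σ∈ ys f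
    Σ∈-++ f []       ys = sym (+-identityˡ _)
    Σ∈-++ f (x ∷ xs) ys = trans (+-congˡ (Σ∈-++ f xs ys)) (sym (+-assoc _ _ _))

  Σ∈-map : ∀ {A B : Set} (f : B → Carrier) (g : A → B) xs → Σ∈ (map g xs) f ≡ Σ∈ xs (f ∘ g)
  Σ∈-map f g []       = ≡.refl
  Σ∈-map f g (x ∷ xs) = ≡.cong (f (g x) +_) (Σ∈-map f g xs)

  sumTo-suc : ∀ n (f : ℕ → Carrier) → sumTo (suc n) f ≡ f 0 + sumTo n (f ∘ suc)
  sumTo-suc n f = ≡.cong (λ l → sumL l) (≡.trans (map-upTo f (suc n)) (≡.cong (f 0 ∷_) (≡.sym (map-upTo (f ∘ suc) n))))

  sumTo-cong : ∀ n {f g : ℕ → Carrier} → (∀ i → i < n → f i ≈ g i) → sumTo n f ≈ sumTo n g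
  sumTo-cong zero    e = refl
  sumTo-cong (suc n) {f} {g} e = begin
    sumTo (suc n) f            ≡⟨ sumTo-suc n f ⟩
    f 0 + sumTo n (f ∘ suc)    ≈⟨ +-cong (e 0 (s≤s z≤n)) (sumTo-cong n (λ i i<n → e (suc i) (s≤s i<n))) ⟩
    g 0 + sumTo n (g ∘ suc)    ≡⟨ sumTo-suc n g ⟨
    sumTo (suc n) g            ∎

  -- Formal power series

  _≋_ : Series → Series → Set ℓ
  f ≋ g = ∀ n → f n ≈ g n

  ⊛-suc : ∀ f g n → (f ⊛ g) (suc n) ≡ f 0 * g (suc n) + ((f ∘ suc) ⊛ g) n
  ⊛-suc f g n = sumTo-suc (suc n) (λ i → f i * g (suc n ∸ i))

  ⊛-zero : ∀ f g → (f ⊛ g) 0 ≈ f 0 * g 0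
  ⊛-zero f g = +-identityʳ (f 0 * g 0)

  ⊛-cong : ∀ {f f′ g g′} → f ≋ f′ → g ≋ g′ → (f ⊛ g) ≋ (f′ ⊛ g′)
  ⊛-cong ef eg n = Σ∈-cong (upTo (suc n)) (λ i → *-cong (ef i) (eg (n ∸ i)))

  ⊛-+ˡ : ∀ f g h n → ((λ i → f i + g i) ⊛ h) n ≈ (f ⊛ h) n + (g ⊛ h) n
  ⊛-+ˡ f g h n = trans (Σ∈-cong (upTo (suc n)) (λ i → distribʳ _ _ _)) (Σ∈-+ _ _ (upTo (suc n)))

  ⊛-+ʳ : ∀ f g h n → (f ⊛ (λ i → g i + h i)) n ≈ (f ⊛ g) n + (f ⊛ h) n
  ⊛-+ʳ f g h n = trans (Σ∈-cong (upTo (suc n)) (λ i → distribˡ _ _ _)) (Σ∈-+ _ _ (upTo (suc n)))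

  ⊛-scaleˡ : ∀ x f g n → (scale x f ⊛ g) n ≈ x * (f ⊛ g) n
  ⊛-scaleˡ x f g n = trans (Σ∈-cong (upTo (suc n)) (λ i → *-assoc _ _ _)) (Σ∈-*ˡ x _ (upTo (suc n)))

  ⊛-scaleʳ : ∀ x f g n → (f ⊛ scale x g) n ≈ x * (f ⊛ g) n
  ⊛-scaleʳ x f g n = trans
    (Σ∈-cong (upTo (suc n)) (λ i → solve 3 (λ a b c → a :* (b :* c) := b :* (a :* c)) refl (f i) x (g (n ∸ i))))
    (Σ∈-*ˡ x _ (upTo (suc n)))

  ⊛-sucʳ : ∀ f g n → (f ⊛ g) (suc n) ≈ (f ⊛ (g ∘ suc)) n + f (suc n) * g 0
  ⊛-sucʳ f g zero = begin
    (f ⊛ g) 1                                    ≡⟨ ⊛-suc f g 0 ⟩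
    f 0 * g 1 + ((f ∘ suc) ⊛ g) 0                ≈⟨ +-cong (sym (⊛-zero f (g ∘ suc))) (⊛-zero (f ∘ suc) g) ⟩
    (f ⊛ (g ∘ suc)) 0 + f 1 * g 0                ∎
  ⊛-sucʳ f g (suc n) = begin
    (f ⊛ g) (suc (suc n))                                                 ≡⟨ ⊛-suc f g (suc n) ⟩
    f 0 * g (suc (suc n)) + ((f ∘ suc) ⊛ g) (suc n)                       ≈⟨ +-congˡ (⊛-sucʳ (f ∘ suc) g n) ⟩
    f 0 * g (suc (suc n)) + (((f ∘ suc) ⊛ (g ∘ suc)) n + f (suc (suc n)) * g 0) ≈⟨ +-assoc _ _ _ ⟨
    f 0 * g (suc (suc n)) + ((f ∘ suc) ⊛ (g ∘ suc)) n + f (suc (suc n)) * g 0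
      ≡⟨ ≡.cong (_+ f (suc (suc n)) * g 0) (⊛-suc f (g ∘ suc) n) ⟨
    (f ⊛ (g ∘ suc)) (suc n) + f (suc (suc n)) * g 0                       ∎

  ⊛-comm : ∀ f g → (f ⊛ g) ≋ (g ⊛ f)
  ⊛-comm f g zero    = +-congʳ (*-comm (f 0) (g 0))
  ⊛-comm f g (suc n) = begin
    (f ⊛ g) (suc n)                         ≡⟨ ⊛-suc f g n ⟩
    f 0 * g (suc n) + ((f ∘ suc) ⊛ g) n     ≈⟨ +-cong (*-comm _ _) (⊛-comm (f ∘ suc) g n) ⟩
    g (suc n) * f 0 + (g ⊛ (f ∘ suc)) n     ≈⟨ +-comm _ _ ⟩
    (g ⊛ (f ∘ suc)) n + g (suc n) * f 0     ≈⟨ ⊛-sucʳ g f n ⟨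
    (g ⊛ f) (suc n)                         ∎

  -- Induction on the degree, for all `f` at once: without its constant term, `f ⊛ g` is `f 0` times
  -- the shifted `g` plus the shifted `f` times `g`.
  ⊛-assoc : ∀ f g h → ((f ⊛ g) ⊛ h) ≋ (f ⊛ (g ⊛ h))
  ⊛-assoc f g h zero = begin
    ((f ⊛ g) ⊛ h) 0     ≈⟨ trans (⊛-zero (f ⊛ g) h) (*-congʳ (⊛-zero f g)) ⟩
    f 0 * g 0 * h 0     ≈⟨ *-assoc _ _ _ ⟩
    f 0 * (g 0 * h 0)   ≈⟨ trans (⊛-zero f (g ⊛ h)) (*-congˡ (⊛-zero g h)) ⟨
    (f ⊛ (g ⊛ h)) 0     ∎
  ⊛-assoc f g h (suc n) = begin
    ((f ⊛ g) ⊛ h) (suc n)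
      ≡⟨ ⊛-suc (f ⊛ g) h n ⟩
    (f ⊛ g) 0 * h (suc n) + (((f ⊛ g) ∘ suc) ⊛ h) n
      ≈⟨ +-cong (*-congʳ (⊛-zero f g)) (⊛-cong {g = h} (λ i → reflexive (⊛-suc f g i)) (λ _ → refl) n) ⟩
    f 0 * g 0 * h (suc n) + ((λ i → scale (f 0) (g ∘ suc) i + ((f ∘ suc) ⊛ g) i) ⊛ h) n
      ≈⟨ +-congˡ (⊛-+ˡ (scale (f 0) (g ∘ suc)) ((f ∘ suc) ⊛ g) h n) ⟩
    f 0 * g 0 * h (suc n) + ((scale (f 0) (g ∘ suc) ⊛ h) n + (((f ∘ suc) ⊛ g) ⊛ h) n)
      ≈⟨ +-congˡ (+-cong (⊛-scaleˡ (f 0) (g ∘ suc) h n) (⊛-assoc (f ∘ suc) g h n)) ⟩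
    f 0 * g 0 * h (suc n) + (f 0 * ((g ∘ suc) ⊛ h) n + ((f ∘ suc) ⊛ (g ⊛ h)) n)
      ≈⟨ solve 5 (λ a b c d e → a :* b :* c :+ (a :* d :+ e) := a :* (b :* c :+ d) :+ e) refl
           (f 0) (g 0) (h (suc n)) _ _ ⟩
    f 0 * (g 0 * h (suc n) + ((g ∘ suc) ⊛ h) n) + ((f ∘ suc) ⊛ (g ⊛ h)) n
      ≡⟨ ≡.cong (λ t → f 0 * t + ((f ∘ suc) ⊛ (g ⊛ h)) n) (⊛-suc g h n) ⟨
    f 0 * (g ⊛ h) (suc n) + ((f ∘ suc) ⊛ (g ⊛ h)) n
      ≡⟨ ⊛-suc f (g ⊛ h) n ⟨
    (f ⊛ (g ⊛ h)) (suc n) ∎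

  ⊛-zsʳ : ∀ f g n → (f ⊛ zs g) (suc n) ≈ (f ⊛ g) n
  ⊛-zsʳ f g n = trans (⊛-sucʳ f (zs g) n) (trans (+-congˡ (zeroʳ _)) (+-identityʳ _))

  ⊛-zs-zero : ∀ f g → (f ⊛ zs g) 0 ≈ 0#
  ⊛-zs-zero f g = trans (⊛-zero f (zs g)) (zeroʳ _)

  -- The continued fractions and their path recursion

  -- Every recursive call lowers the fuel by one and the degree by at least one, so fuel above the
  -- degree never runs out.
  Jf-fuel : ∀ f f′ h n → n < f → n < f′ → Jf f h n ≈ Jf f′ h n
  Jf-fuel (suc f) (suc f′) h zero _ _ = refl
  Jf-fuel (suc f) (suc f′) h (suc zero) (s≤s n<f) (s≤s n<f′) = +-congʳ (*-congˡ (Jf-fuel f f′ h 0 n<f n<f′))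
  Jf-fuel (suc f) (suc f′) h (suc (suc m)) (s≤s n<f) (s≤s n<f′) =
    +-cong (*-congˡ (Jf-fuel f f′ h (suc m) n<f n<f′))
           (*-congˡ (sumTo-cong (suc m) λ i i≤m →
             *-cong (Jf-fuel f f′ (suc h) i (Nₚ.<-trans i≤m n<f) (Nₚ.<-trans i≤m n<f′))
                    (Jf-fuel f f′ h (m ∸ i) (Nₚ.≤-<-trans (Nₚ.m∸n≤m m i) (Nₚ.<-trans (Nₚ.n<1+n m) n<f))
                                            (Nₚ.≤-<-trans (Nₚ.m∸n≤m m i) (Nₚ.<-trans (Nₚ.n<1+n m) n<f′)))))

  -- Clearing the denominator of the continued fraction gives `J_h = 1 + c_h z J_h + a_h z^2 J_h
  -- J_{h+1}`. The recursive calls carry more fuel than `J` does, which `Jf-fuel` reconciles.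
  J-suc : ∀ h n → J h (suc n) ≈ cc h * J h n + zs (scale (a h) (J h ⊛ J (suc h))) n
  J-suc h zero    = refl
  J-suc h (suc m) = +-congˡ (*-congˡ (trans
    (sumTo-cong (suc m) λ i i≤m →
      *-cong (Jf-fuel (suc (suc m)) (suc i) (suc h) i (Nₚ.<-trans i≤m (Nₚ.n<1+n _)) (Nₚ.n<1+n i))
             (Jf-fuel (suc (suc m)) (suc (m ∸ i)) h (m ∸ i)
               (s≤s (Nₚ.≤-trans (Nₚ.m∸n≤m m i) (Nₚ.n≤1+n m))) (Nₚ.n<1+n _)))
    (⊛-comm (J (suc h)) (J h) m)))

  -- The up step into height `s`, of weight `a_{s-1}`. By `Σ-step` the same operator describes the
  -- choice of a block to join, and this coincidence links partitions to paths.
  D : (ℕ → Carrier) → ℕ → Carrier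
  D k zero    = 0#
  D k (suc s) = a s * k s

  K-zero : ∀ s → K (suc s) 0 ≈ 0#
  K-zero s = ⊛-zs-zero (K s) (scale (a s) (J (suc s)))

  -- K s counts weighted Motzkin paths from height 0 to height s: split off the last step.
  K-suc : ∀ s n → K s (suc n) ≈ K (suc s) n + cc s * K s n + D (λ t → K t n) s
  K-suc zero n = begin
    J 0 (suc n)                                            ≈⟨ J-suc 0 n ⟩
    cc 0 * J 0 n + zs (scale (a 0) (J 0 ⊛ J 1)) n          ≈⟨ +-congˡ (K₁ n) ⟨
    cc 0 * J 0 n + K 1 n                                   ≈⟨ solve 2 (λ x y → x :+ y := y :+ x :+ con 0) refl _ _ ⟩
    K 1 n + cc 0 * J 0 n + 0#                              ∎
    where
    K₁ : ∀ n → K 1 n ≈ zs (scale (a 0) (J 0 ⊛ J 1)) n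
    K₁ zero    = K-zero 0
    K₁ (suc n) = trans (⊛-zsʳ (J 0) (scale (a 0) (J 1)) n) (⊛-scaleʳ (a 0) (J 0) (J 1) n)
  K-suc (suc s) n = begin
    K (suc s) (suc n)
      ≈⟨ K-coeff n ⟩
    a s * (K s ⊛ J (suc s)) n
      ≈⟨ last-step n ⟩
    K (suc (suc s)) n + cc (suc s) * K (suc s) n + a s * K s n ∎
    where
    J′ J″ : Series
    J′ = J (suc s)
    J″ = J (suc (suc s))
    K-coeff : ∀ n → K (suc s) (suc n) ≈ a s * (K s ⊛ J′) n
    K-coeff n = trans (⊛-zsʳ (K s) (scale (a s) J′) n) (⊛-scaleʳ (a s) (K s) J′ n)
    K₂ : ∀ n → K (suc (suc s)) (suc n) ≈ a (suc s) * (K (suc s) ⊛ J″) n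
    K₂ n = trans (⊛-zsʳ (K (suc s)) (scale (a (suc s)) J″) n) (⊛-scaleʳ (a (suc s)) (K (suc s)) J″ n)
    -- Since `K_{s+1} = a_s z K_s J′` and `K_{s+2} = a_{s+1} z K_{s+1} J″`, the series on the left
    -- is `K_{s+2}` divided by z.
    last-up : ∀ n → a s * (K s ⊛ zs (scale (a (suc s)) (J′ ⊛ J″))) n ≈ K (suc (suc s)) (suc n)
    last-up zero = begin
      a s * (K s ⊛ zs (scale (a (suc s)) (J′ ⊛ J″))) 0   ≈⟨ *-congˡ (⊛-zs-zero (K s) (scale (a (suc s)) (J′ ⊛ J″))) ⟩
      a s * 0#                                           ≈⟨ zeroʳ _ ⟩
      0#                                                 ≈⟨ zeroʳ _ ⟨
      a (suc s) * 0#                                     ≈⟨ *-congˡ (zeroˡ _) ⟨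
      a (suc s) * (0# * J″ 0)                            ≈⟨ *-congˡ (*-congʳ (K-zero s)) ⟨
      a (suc s) * (K (suc s) 0 * J″ 0)                   ≈⟨ *-congˡ (⊛-zero (K (suc s)) J″) ⟨
      a (suc s) * (K (suc s) ⊛ J″) 0                     ≈⟨ K₂ 0 ⟨
      K (suc (suc s)) 1                                  ∎
    last-up (suc m) = begin
      a s * (K s ⊛ zs (scale (a (suc s)) (J′ ⊛ J″))) (suc m)
        ≈⟨ *-congˡ (trans (⊛-zsʳ (K s) (scale (a (suc s)) (J′ ⊛ J″)) m) (⊛-scaleʳ (a (suc s)) (K s) (J′ ⊛ J″) m)) ⟩
      a s * (a (suc s) * (K s ⊛ (J′ ⊛ J″)) m)
        ≈⟨ *-congˡ (*-congˡ (⊛-assoc (K s) J′ J″ m)) ⟨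
      a s * (a (suc s) * ((K s ⊛ J′) ⊛ J″) m)
        ≈⟨ solve 3 (λ x y z → x :* (y :* z) := y :* (x :* z)) refl (a s) (a (suc s)) _ ⟩
      a (suc s) * (a s * ((K s ⊛ J′) ⊛ J″) m)
        ≈⟨ *-congˡ (⊛-scaleˡ (a s) (K s ⊛ J′) J″ m) ⟨
      a (suc s) * (scale (a s) (K s ⊛ J′) ⊛ J″) m
        ≈⟨ *-congˡ (⊛-cong {g = J″} K-coeff (λ _ → refl) m) ⟨
      a (suc s) * ((K (suc s) ∘ suc) ⊛ J″) m
        ≈⟨ *-congˡ (trans (+-congʳ (trans (*-congʳ (K-zero s)) (zeroˡ _))) (+-identityˡ _)) ⟨
      a (suc s) * (K (suc s) 0 * J″ (suc m) + ((K (suc s) ∘ suc) ⊛ J″) m)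
        ≡⟨ ≡.cong (a (suc s) *_) (⊛-suc (K (suc s)) J″ m) ⟨
      a (suc s) * (K (suc s) ⊛ J″) (suc m)
        ≈⟨ K₂ (suc m) ⟨
      K (suc (suc s)) (suc (suc m)) ∎
    -- Here `J′` is the final excursion at height `s + 1`. Its functional equation has three terms:
    -- if the excursion is empty, the last step is the up step from `s`; otherwise it is a level
    -- step, or a down step from `s + 2`.
    last-step : ∀ n → a s * (K s ⊛ J′) n ≈ K (suc (suc s)) n + cc (suc s) * K (suc s) n + a s * K s n
    last-step zero = begin
      a s * (K s ⊛ J′) 0                                ≈⟨ *-congˡ (trans (⊛-zero (K s) J′) (*-identityʳ _)) ⟩
      a s * K s 0
        ≈⟨ solve 2 (λ x y → y := con 0 :+ x :* con 0 :+ y) refl (cc (suc s)) (a s * K s 0) ⟩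
      0# + cc (suc s) * 0# + a s * K s 0                ≈⟨ +-congʳ (+-cong (K-zero (suc s)) (*-congˡ (K-zero s))) ⟨
      K (suc (suc s)) 0 + cc (suc s) * K (suc s) 0 + a s * K s 0 ∎
    last-step (suc n) = begin
      a s * (K s ⊛ J′) (suc n)
        ≈⟨ *-congˡ (⊛-sucʳ (K s) J′ n) ⟩
      a s * ((K s ⊛ (J′ ∘ suc)) n + K s (suc n) * 1#)
        ≈⟨ *-congˡ (+-cong (trans (⊛-cong {K s} (λ _ → refl) (J-suc (suc s)) n)
                                  (⊛-+ʳ (K s) (scale (cc (suc s)) J′) (zs (scale (a (suc s)) (J′ ⊛ J″))) n))
                           (*-identityʳ _)) ⟩
      a s * ((K s ⊛ scale (cc (suc s)) J′) n + (K s ⊛ zs (scale (a (suc s)) (J′ ⊛ J″))) n + K s (suc n))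
        ≈⟨ *-congˡ (+-congʳ (+-congʳ (⊛-scaleʳ (cc (suc s)) (K s) J′ n))) ⟩
      a s * (cc (suc s) * (K s ⊛ J′) n + (K s ⊛ zs (scale (a (suc s)) (J′ ⊛ J″))) n + K s (suc n))
        ≈⟨ solve 5 (λ x c y z t → x :* (c :* y :+ z :+ t) := x :* z :+ c :* (x :* y) :+ x :* t) refl
             (a s) (cc (suc s)) _ _ _ ⟩
      a s * (K s ⊛ zs (scale (a (suc s)) (J′ ⊛ J″))) n + cc (suc s) * (a s * (K s ⊛ J′) n) + a s * K s (suc n)
        ≈⟨ +-congʳ (+-cong (last-up n) (*-congˡ (sym (K-coeff n)))) ⟩
      K (suc (suc s)) (suc n) + cc (suc s) * K (suc s) (suc n) + a s * K s (suc n) ∎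

  qp-suc : ∀ s → qp (suc s) ≈ pow p s + q * qp s
  qp-suc s = begin
    qp (suc s)
      ≡⟨ sumTo-suc s (λ i → pow q i * pow p (suc s ∸ suc i)) ⟩
    1# * pow p s + sumTo s (λ i → q * pow q i * pow p (s ∸ suc i))
      ≈⟨ +-cong (*-identityˡ _) (Σ∈-cong (upTo s) (λ i → *-assoc q (pow q i) (pow p (s ∸ suc i)))) ⟩
    pow p s + sumTo s (λ i → q * (pow q i * pow p (s ∸ suc i)))
      ≈⟨ +-congˡ (Σ∈-*ˡ q (λ i → pow q i * pow p (s ∸ suc i)) (upTo s)) ⟩
    pow p s + q * qp s ∎

  -- Elementary symmetric polynomials

  -- E ys k = Σ_s e_s(ys) k_s
  E : List Carrier → (ℕ → Carrier) → Carrier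
  E []       k = k 0
  E (y ∷ ys) k = E ys k + y * E ys (k ∘ suc)

  E-cong : ∀ ys {k k′} → (∀ s → k s ≈ k′ s) → E ys k ≈ E ys k′
  E-cong []       e = e 0
  E-cong (y ∷ ys) e = +-cong (E-cong ys e) (*-congˡ (E-cong ys (e ∘ suc)))

  E-+ : ∀ ys k k′ → E ys (λ s → k s + k′ s) ≈ E ys k + E ys k′
  E-+ []       k k′ = refl
  E-+ (y ∷ ys) k k′ = begin
    E ys (λ s → k s + k′ s) + y * E ys (λ s → k (suc s) + k′ (suc s))
      ≈⟨ +-cong (E-+ ys k k′) (*-congˡ (E-+ ys (k ∘ suc) (k′ ∘ suc))) ⟩
    E ys k + E ys k′ + y * (E ys (k ∘ suc) + E ys (k′ ∘ suc))
      ≈⟨ solve 5 (λ y a b c d → a :+ b :+ y :* (c :+ d) := a :+ y :* c :+ (b :+ y :* d)) refl y _ _ _ _ ⟩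
    E (y ∷ ys) k + E (y ∷ ys) k′ ∎

  E-*ˡ : ∀ x ys k → E ys (λ s → x * k s) ≈ x * E ys k
  E-*ˡ x []       k = refl
  E-*ˡ x (y ∷ ys) k = begin
    E ys (λ s → x * k s) + y * E ys (λ s → x * k (suc s))
      ≈⟨ +-cong (E-*ˡ x ys k) (*-congˡ (E-*ˡ x ys (k ∘ suc))) ⟩
    x * E ys k + y * (x * E ys (k ∘ suc))
      ≈⟨ solve 4 (λ x y a b → x :* a :+ y :* (x :* b) := x :* (a :+ y :* b)) refl x y _ _ ⟩
    x * E (y ∷ ys) k ∎

  E-zero : ∀ ys k → (∀ s → k s ≈ 0#) → E ys k ≈ 0#
  E-zero []       k z = z 0
  E-zero (y ∷ ys) k z =
    trans (+-cong (E-zero ys k z) (*-congˡ (E-zero ys (k ∘ suc) (z ∘ suc)))) (trans (+-identityˡ _) (zeroʳ y))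

  E-constant : ∀ ys k → (∀ s → k (suc s) ≈ 0#) → E ys k ≈ k 0
  E-constant []       k z = refl
  E-constant (y ∷ ys) k z =
    trans (+-cong (E-constant ys k z) (trans (*-congˡ (E-zero ys (k ∘ suc) z)) (zeroʳ y))) (+-identityʳ (k 0))

  elem : ℕ → List Carrier → Carrier
  elem zero    ys       = 1#
  elem (suc r) []       = 0#
  elem (suc r) (y ∷ ys) = y * elem r ys + elem (suc r) ys

  -- `e_s` vanishes once `s` exceeds the number of variables, so the cutoff loses nothing. With the
  -- k - 1 steps of the other blocks and `n = k` it gives the range of `s` in the theorem.
  E-elem : ∀ ys k n → length ys < n → E ys k ≈ sumTo n (λ s → elem s ys * k s)
  E-elem [] k (suc n) _ = begin
    k 0                                   ≈⟨ solve 1 (λ x → x := con 1 :* x :+ con 0) refl (k 0) ⟩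
    1# * k 0 + 0#                         ≈⟨ +-congˡ (Σ∈-zero (λ s → 0# * k (suc s)) (upTo n) (λ s → zeroˡ _)) ⟨
    1# * k 0 + sumTo n (λ s → 0# * k (suc s)) ≡⟨ sumTo-suc n (λ s → elem s [] * k s) ⟨
    sumTo (suc n) (λ s → elem s [] * k s) ∎
  E-elem (y ∷ ys) k (suc n) (s≤s ys<n) = begin
    E ys k + y * E ys (k ∘ suc)
      ≈⟨ +-cong (E-elem ys k (suc n) (Nₚ.m<n⇒m<1+n ys<n)) (*-congˡ (E-elem ys (k ∘ suc) n ys<n)) ⟩
    sumTo (suc n) (λ s → elem s ys * k s) + y * sumTo n (λ s → elem s ys * k (suc s))
      ≈⟨ +-cong (reflexive (sumTo-suc n (λ s → elem s ys * k s)))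
                (sym (Σ∈-*ˡ y (λ s → elem s ys * k (suc s)) (upTo n))) ⟩
    1# * k 0 + sumTo n (λ s → elem (suc s) ys * k (suc s)) + sumTo n (λ s → y * (elem s ys * k (suc s)))
      ≈⟨ solve 3 (λ a b c → a :+ b :+ c := a :+ (c :+ b)) refl _ _ _ ⟩
    1# * k 0 + (sumTo n (λ s → y * (elem s ys * k (suc s))) + sumTo n (λ s → elem (suc s) ys * k (suc s)))
      ≈⟨ +-congˡ (Σ∈-+ (λ s → y * (elem s ys * k (suc s))) (λ s → elem (suc s) ys * k (suc s)) (upTo n)) ⟨
    1# * k 0 + sumTo n (λ s → y * (elem s ys * k (suc s)) + elem (suc s) ys * k (suc s))
      ≈⟨ +-congˡ (Σ∈-cong (upTo n) (λ s → trans (+-congʳ (sym (*-assoc y _ _))) (sym (distribʳ (k (suc s)) _ _)))) ⟩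
    1# * k 0 + sumTo n (λ s → elem (suc s) (y ∷ ys) * k (suc s))
      ≡⟨ sumTo-suc n (λ s → elem s (y ∷ ys) * k s) ⟨
    sumTo (suc n) (λ s → elem s (y ∷ ys) * k s) ∎

  -- Weights of words and steps of blocks

  pow-+ : ∀ x m n → pow x (m N.+ n) ≈ pow x m * pow x n
  pow-+ x zero    n = sym (*-identityˡ _)
  pow-+ x (suc m) n = trans (*-congˡ (pow-+ x m n)) (sym (*-assoc x _ _))

  monomial : ℕ → ℕ → Carrier
  monomial i j = pow q i * pow p j

  monomial-+ : ∀ i i′ j j′ → monomial (i N.+ i′) (j N.+ j′) ≈ monomial i j * monomial i′ j′
  monomial-+ i i′ j j′ = trans (*-cong (pow-+ q i i′) (pow-+ p j j′))
    (solve 4 (λ a b c d → a :* b :* (c :* d) := a :* c :* (b :* d)) refl _ _ _ _)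

  weight : List ℕ → Carrier
  weight w = monomial (cr w) (ne w)

  step : List ℕ → ℕ → Carrier
  step w x = monomial (newCr (findIdx x w) (arcs w)) (newNe (findIdx x w) (arcs w))

  weight-∷ : ∀ x w → weight (x ∷ w) ≈ weight w * step w x
  weight-∷ x w rewrite cr-∷ x w | ne-∷ x w =
    monomial-+ (cr w) (newCr (findIdx x w) (arcs w)) (ne w) (newNe (findIdx x w) (arcs w))

  weight-code : ∀ w w′ → code w ≡ code w′ → weight w ≡ weight w′
  weight-code w w′ e =
    ≡.cong (λ as → monomial (count isCrossing (pairs as)) (count isNesting (pairs as))) (code-arcs w w′ e)

  step-first : ∀ x w → step (x ∷ w) x ≈ 1#
  step-first x w rewrite findIdx-here x w | newCr-zero (arcs (x ∷ w)) | newNe-zero (arcs (x ∷ w)) = *-identityˡ 1#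

  step-absent : ∀ {x} w → findIdx x w ≡ nothing → step w x ≈ 1#
  step-absent w e rewrite e = *-identityˡ 1#

  step-there : ∀ {x y m} w → x ≢ y → findIdx x w ≡ just m →
               step (y ∷ w) x ≡ monomial (newCr (just (suc m)) (arcs (y ∷ w))) (newNe (just (suc m)) (arcs (y ∷ w)))
  step-there {x} {y} w x≢y e =
    ≡.cong (λ o → monomial (newCr o (arcs (y ∷ w))) (newNe o (arcs (y ∷ w))))
           (≡.trans (findIdx-there w x≢y) (≡.cong (Maybe.map suc) e))

  step-fresh : ∀ {x} w → x ∈ labels w → step (fresh w ∷ w) x ≈ step w x
  step-fresh {x} w x∈ with ∈-labels⁻ w x∈
  ... | m , ex = reflexive (≡.trans
    (step-there w (λ x≡f → All.lookup (fresh∉labels w) x∈ (≡.sym x≡f)) ex)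
    (≡.cong₂ monomial (newCr-fresh {w} {x} ex (findIdx-fresh w)) (newNe-fresh {w} {x} ex (findIdx-fresh w))))

  step-after : ∀ w {x y} → Before w x y → step (y ∷ w) x ≈ q * step w x
  step-after w {x} {y} b@(i , j , ex , ey , i<j) = trans
    (reflexive (≡.trans (step-there w (Before⇒≢ w b) ex)
      (≡.cong₂ monomial (newCr-after {w} {x} ex ey i<j) (newNe-after {w} {x} ex ey i<j))))
    (*-assoc q _ _)

  step-before : ∀ w {x y} → Before w y x → step (y ∷ w) x ≈ p * step w x
  step-before w {x} {y} b@(j , i , ey , ex , j<i) = trans
    (reflexive (≡.trans (step-there w (Before⇒≢ w b ∘ ≡.sym) ex)
      (≡.cong₂ monomial (newCr-before {w} {x} ex ey j<i) (newNe-before {w} {x} ex ey j<i))))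
    (solve 3 (λ a b c → a :* (b :* c) := b :* (a :* c)) refl _ p _)

  -- Summing over the block that is joined

  E-map-cong : ∀ {f g : ℕ → Carrier} {xs} → All (λ x → f x ≈ g x) xs → ∀ k → E (map f xs) k ≈ E (map g xs) k
  E-map-cong []       k = refl
  E-map-cong (e ∷ es) k = +-cong (E-map-cong es k) (*-cong e (E-map-cong es (k ∘ suc)))

  -- `e_s` is homogeneous of degree `s`.
  E-map-p : ∀ (f : ℕ → Carrier) xs k → E (map (λ x → p * f x) xs) k ≈ E (map f xs) (λ s → pow p s * k s)
  E-map-p f []       k = sym (*-identityˡ (k 0))
  E-map-p f (x ∷ xs) k = begin
    E (map (λ x → p * f x) xs) k + p * f x * E (map (λ x → p * f x) xs) (k ∘ suc)
      ≈⟨ +-cong (E-map-p f xs k) (*-congˡ (E-map-p f xs (k ∘ suc))) ⟩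
    E (map f xs) (λ s → pow p s * k s) + p * f x * E (map f xs) (λ s → pow p s * k (suc s))
      ≈⟨ +-congˡ (solve 3 (λ a b c → a :* b :* c := b :* (a :* c)) refl p (f x) _) ⟩
    E (map f xs) (λ s → pow p s * k s) + f x * (p * E (map f xs) (λ s → pow p s * k (suc s)))
      ≈⟨ +-congˡ (*-congˡ (E-*ˡ p (map f xs) (λ s → pow p s * k (suc s)))) ⟨
    E (map f xs) (λ s → pow p s * k s) + f x * E (map f xs) (λ s → p * (pow p s * k (suc s)))
      ≈⟨ +-congˡ (*-congˡ (E-cong (map f xs) (λ s → *-assoc p _ _))) ⟨
    E (map f (x ∷ xs)) (λ s → pow p s * k s) ∎

  -- This is `[s+1] = p^s + q [s]`. In `Σ-step` the first summand stands for distinguishing the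
  -- earliest block of the chosen set, the second for distinguishing a later one, when the earliest
  -- contributes `q`.
  D-suc : ∀ k s → D k (suc s) ≈ pow p s * k s + q * D (k ∘ suc) s
  D-suc k zero = solve 3 (λ x y q → (con 1 :* con 1 :+ con 0) :* x := con 1 :* x :+ q :* con 0) refl (k 0) 0# q
  D-suc k (suc s) = begin
    qp (suc (suc s)) * k (suc s)                    ≈⟨ *-congʳ (qp-suc (suc s)) ⟩
    (pow p (suc s) + q * qp (suc s)) * k (suc s)
      ≈⟨ solve 4 (λ a b c d → (a :+ b :* c) :* d := a :* d :+ b :* (c :* d)) refl _ q _ (k (suc s)) ⟩
    pow p (suc s) * k (suc s) + q * (qp (suc s) * k (suc s)) ∎

  Σ∈-cong-All : ∀ {A : Set} {f g : A → Carrier} {xs} → All (λ x → f x ≈ g x) xs → Σ∈ xs f ≈ Σ∈ xs g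
  Σ∈-cong-All []       = refl
  Σ∈-cong-All (e ∷ es) = +-cong e (Σ∈-cong-All es)

  -- A set of s+1 letters with one of them distinguished has weight q^i p^(s-i) when i of the others
  -- come before the distinguished one; summing over the choice of that letter gives [s+1].
  Σ-step : ∀ w xs → AllPairs (Before w) xs → ∀ k →
           Σ∈ xs (λ x → step w x * E (map (step (x ∷ w)) (remove x xs)) k) ≈ E (map (step w) xs) (D k)
  Σ-step w [] [] k = refl
  Σ-step w (z ∷ xs) (z< ∷ sorted) k = begin
    step w z * E (map (step (z ∷ w)) (remove z (z ∷ xs))) k
      + Σ∈ xs (λ x → step w x * E (map (step (x ∷ w)) (remove x (z ∷ xs))) k)
      ≈⟨ +-cong (*-congˡ joined-first) (trans (Σ∈-cong-All (All.map joined-later z<)) (Σ∈-+ _ _ xs)) ⟩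
    step w z * E ys (λ s → pow p s * k s)
      + (Σ∈ xs (λ x → step w x * rest x k) + Σ∈ xs (λ x → q * step w z * (step w x * rest x (k ∘ suc))))
      ≈⟨ +-congˡ (+-cong (Σ-step w xs sorted k)
           (trans (Σ∈-*ˡ (q * step w z) _ xs) (*-congˡ (Σ-step w xs sorted (k ∘ suc))))) ⟩
    step w z * E ys (λ s → pow p s * k s) + (E ys (D k) + q * step w z * E ys (D (k ∘ suc)))
      -- Regrouped by whether `z` belongs to the chosen set; if it does, it is either distinguished
      -- or carries the extra `q`.
      ≈⟨ solve 5 (λ z a b q c → z :* a :+ (b :+ q :* z :* c) := b :+ z :* (a :+ q :* c)) refl (step w z) _ _ q _ ⟩
    E ys (D k) + step w z * (E ys (λ s → pow p s * k s) + q * E ys (D (k ∘ suc)))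
      ≈⟨ +-congˡ (*-congˡ (trans (E-+ ys _ _) (+-congˡ (E-*ˡ q ys (D (k ∘ suc)))))) ⟨
    E ys (D k) + step w z * E ys (λ s → pow p s * k s + q * D (k ∘ suc) s)
      ≈⟨ +-congˡ (*-congˡ (E-cong ys (D-suc k))) ⟨
    E ys (D k) + step w z * E ys (D k ∘ suc) ∎
    where
    ys : List Carrier
    ys = map (step w) xs
    rest : ℕ → (ℕ → Carrier) → Carrier
    rest x k = E (map (step (x ∷ w)) (remove x xs)) k
    -- All blocks of `xs` start after that of `z`, so each chosen one gains a factor `p`.
    joined-first : E (map (step (z ∷ w)) (remove z (z ∷ xs))) k ≈ E ys (λ s → pow p s * k s)
    joined-first rewrite remove-here z xs | remove-absent (All.map (Before⇒≢ w) z<) =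
      trans (E-map-cong (All.map (step-before w) z<) k) (E-map-p (step w) xs k)
    joined-later : ∀ {x} → Before w z x → step w x * E (map (step (x ∷ w)) (remove x (z ∷ xs))) k
                   ≈ step w x * rest x k + q * step w z * (step w x * rest x (k ∘ suc))
    joined-later {x} z<x rewrite remove-there xs (Before⇒≢ w z<x ∘ ≡.sym) = begin
      step w x * (rest x k + step (x ∷ w) z * rest x (k ∘ suc))
        ≈⟨ *-congˡ (+-congˡ (*-congʳ (step-after w z<x))) ⟩
      step w x * (rest x k + q * step w z * rest x (k ∘ suc))
        ≈⟨ solve 5 (λ x a q z b → x :* (a :+ q :* z :* b) := x :* a :+ q :* z :* (x :* b)) refl _ _ q _ _ ⟩
      step w x * rest x k + q * step w z * (step w x * rest x (k ∘ suc)) ∎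

  -- Sums over descendants

  -- The Iverson bracket: it turns filtered sums into sums over all words, whose order can be
  -- exchanged.
  [_]_ : Bool → Carrier → Carrier
  [ b ] x = if b then x else 0#

  Σ∈-filter : ∀ {A : Set} (f : A → Carrier) (φ : A → Bool) xs →
              Σ∈ (filter (λ x → T? (φ x)) xs) f ≈ Σ∈ xs (λ x → [ φ x ] f x)
  Σ∈-filter f φ [] = refl
  Σ∈-filter f φ (x ∷ xs) with φ x
  ... | true  = +-congˡ (Σ∈-filter f φ xs)
  ... | false = trans (Σ∈-filter f φ xs) (sym (+-identityˡ _))

  Σ∈-swap : ∀ {A B : Set} (f : A → B → Carrier) xs ys →
            Σ∈ xs (λ x → Σ∈ ys (f x)) ≈ Σ∈ ys (λ y → Σ∈ xs (λ x → f x y))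
  Σ∈-swap f []       ys = sym (Σ∈-zero _ ys (λ _ → refl))
  Σ∈-swap f (x ∷ xs) ys = trans (+-congˡ (Σ∈-swap f xs ys)) (sym (Σ∈-+ (f x) _ ys))

  Σ∈-concatMap : ∀ {A B : Set} (f : B → Carrier) (h : A → List B) xs →
                 Σ∈ (concatMap h xs) f ≈ Σ∈ xs (λ x → Σ∈ (h x) f)
  Σ∈-concatMap f h []       = refl
  Σ∈-concatMap f h (x ∷ xs) = trans (Σ∈-++ f (h x) _) (+-congˡ (Σ∈-concatMap f h xs))

  Σ∈-single : ∀ {A : Set} (f : A → Carrier) {x xs} → Unique xs → x ∈ xs →
              (∀ {y} → y ∈ xs → y ≢ x → f y ≈ 0#) → Σ∈ xs f ≈ f x
  Σ∈-single f {xs = _ ∷ xs} (x∉ ∷ _) (here ≡.refl) z = trans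
    (+-congˡ (trans (Σ∈-cong-All (All.tabulate λ y∈ → z (there y∈) (All.lookup x∉ y∈ ∘ ≡.sym))) (Σ∈-zero _ xs (λ _ → refl))))
    (+-identityʳ _)
  Σ∈-single f (y∉ ∷ u) (there x∈) z = trans
    (+-cong (z (here ≡.refl) (All.lookup y∉ x∈)) (Σ∈-single f u x∈ (z ∘ there)))
    (+-identityˡ _)

  Σ∈-words-single : ∀ A v (f : List ℕ → Carrier) → All (_< A) v → (∀ v′ → v′ ≢ v → f v′ ≈ 0#) →
                    Σ∈ (words A (length v)) f ≈ f v
  Σ∈-words-single A []      f _ z = +-identityʳ (f [])
  Σ∈-words-single A (x ∷ v) f (x<A ∷ v<A) z = begin
    Σ∈ (concatMap (λ y → map (y ∷_) (words A (length v))) (upTo A)) f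
      ≈⟨ Σ∈-concatMap f _ (upTo A) ⟩
    Σ∈ (upTo A) (λ y → Σ∈ (map (y ∷_) (words A (length v))) f)
      ≈⟨ Σ∈-single _ (upTo⁺ A) (∈-upTo⁺ x<A) (λ {y} _ y≢x →
           trans (reflexive (Σ∈-map f (y ∷_) (words A (length v))))
                 (Σ∈-zero _ (words A (length v)) (λ v′ → z (y ∷ v′) (y≢x ∘ proj₁ ∘ ∷-injective)))) ⟩
    Σ∈ (map (x ∷_) (words A (length v))) f
      ≡⟨ Σ∈-map f (x ∷_) (words A (length v)) ⟩
    Σ∈ (words A (length v)) (f ∘ (x ∷_))
      ≈⟨ Σ∈-words-single A v (f ∘ (x ∷_)) v<A (λ v′ v′≢v → z (x ∷ v′) (v′≢v ∘ proj₂ ∘ ∷-injective)) ⟩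
    f (x ∷ v) ∎

  -- Comparing with `std w` lets `w` be any word, not only a restricted growth string.
  isDescendant : List ℕ → ℕ → List ℕ → Bool
  isDescendant w l v = isRGS v ∧ eqList (std (drop l v)) (std w)

  -- The length `M` is a separate parameter, so that the sums for a word and for its children range
  -- over the same list.
  descendants : ℕ → List ℕ → ℕ → Carrier
  descendants M w l = Σ∈ (words M M) (λ v → [ isDescendant w l v ] weight v)

  -- A restricted growth string is its own standardisation, so the only word that passes the test is
  -- `std w`, which has the arcs of `w`.
  descendants-zero : ∀ M w → M ≡ length w → descendants M w 0 ≈ weight w
  descendants-zero M w M≡ = begin
    descendants M w 0
      ≡⟨ ≡.cong (λ n → Σ∈ (words M n) f) (≡.trans M≡ (≡.sym (length-std′ [] w))) ⟩
    Σ∈ (words M (length (std w))) f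
      ≈⟨ Σ∈-words-single M (std w) f
           (≡.subst (λ n → All (_< n) (std w)) (≡.trans (length-std′ [] w) (≡.sym M≡)) (rgs-bounded 0 (std w) rgs)) others ⟩
    f (std w)
      ≡⟨ ≡.cong₂ (λ b u → [ b ∧ eqList u (std w) ] weight (std w)) (Equivalence.to T-≡ rgs) (std-rgs (std w) rgs) ⟩
    [ eqList (std w) (std w) ] weight (std w)
      ≡⟨ ≡.cong₂ [_]_ (eqList-refl (std w)) (weight-code (std w) w (code-std′ [] w)) ⟩
    weight w ∎
    where
    f : List ℕ → Carrier
    f v = [ isDescendant w 0 v ] weight v
    rgs : T (isRGS (std w))
    rgs = rgs-std′ [] w
    others : ∀ v → v ≢ std w → f v ≈ 0#
    others v v≢ with isRGS v in e
    ... | false = refl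
    ... | true rewrite std-rgs v (Equivalence.from T-≡ e) | eqList-≢ v (std w) v≢ = refl

  -- If `ys` describes the partition of `w`, then `y ∷ ys` is equivalent to exactly one child of
  -- `w`; if it does not, to none.
  child-indicator : ∀ r y ys w t → [ r ∧ eqList (std ys) (std w) ] t ≈
                    Σ∈ (childLetters w) (λ x → [ r ∧ eqList (std (y ∷ ys)) (std (x ∷ w)) ] t)
  child-indicator r y ys w t with ≡-dec _≟_ (std ys) (std w)
  ... | no ys≢w rewrite eqList-≢ (std ys) (std w) ys≢w | ∧-zeroʳ r =
    sym (Σ∈-zero _ (childLetters w) λ x → reflexive (≡.cong ([_] t) (≡.trans
      (≡.cong (r ∧_) (eqList-≢ (std (y ∷ ys)) (std (x ∷ w)) λ e →
        ys≢w (std-cong ys w (proj₂ (∷-injective (std-injective (y ∷ ys) (x ∷ w) e))))))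
      (∧-zeroʳ r))))
  ... | yes ys≡w with child-exists {y} ys w (std-injective ys w ys≡w)
  ...   | x , x∈ , same = sym (trans
    (Σ∈-single _ (childLetters-unique w) x∈ λ {x′} x′∈ x′≢x → reflexive (≡.cong ([_] t) (≡.trans
      (≡.cong (r ∧_) (eqList-≢ (std (y ∷ ys)) (std (x′ ∷ w)) λ e →
        x′≢x (childLetters-injective w x′∈ x∈
          (≡.trans (≡.sym (proj₁ (∷-injective (std-injective (y ∷ ys) (x′ ∷ w) e)))) same))))
      (∧-zeroʳ r))))
    (reflexive (≡.cong (λ b → [ r ∧ b ] t) (≡.trans
      (≡.trans (≡.cong (λ u → eqList u (std (x ∷ w)))
                 (std-cong (y ∷ ys) (x ∷ w) (≡.cong₂ _∷_ same (std-injective ys w ys≡w))))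
               (eqList-refl (std (x ∷ w))))
      (≡.sym (≡.trans (≡.cong (λ u → eqList u (std w)) ys≡w) (eqList-refl (std w))))))))

  -- The bound `l < M` guarantees that in each word some letter remains after dropping `l`. That
  -- letter, in front of the part compared with `w`, decides the child.
  descendants-suc : ∀ M w l → l < M → descendants M w (suc l) ≈ Σ∈ (childLetters w) (λ x → descendants M (x ∷ w) l)
  descendants-suc M w l l<M = trans
    (Σ∈-cong-All (All.map (λ {v} len → split v (≡.subst (l <_) (≡.sym len) l<M)) (words-length M M)))
    (Σ∈-swap (λ v x → [ isDescendant (x ∷ w) l v ] weight v) (words M M) (childLetters w))
    where
    split : ∀ v → l < length v → [ isDescendant w (suc l) v ] weight v
                               ≈ Σ∈ (childLetters w) (λ x → [ isDescendant (x ∷ w) l v ] weight v)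
    split v l<v with drop-split l v l<v
    ... | y , ys , e , e′ rewrite e | e′ = child-indicator (isRGS v) y ys w (weight v)

  -- The block of the leading letter `z` has step 1 and is left out of the variables. For `z = 0`
  -- these are the steps of blocks 2 to k, the indices allowed in `b_{0,s}`.
  descendants-E : ∀ l z w M → M ≡ suc (length w) N.+ l →
                  descendants M (z ∷ w) l ≈
                  weight (z ∷ w) * E (map (step (z ∷ w)) (remove z (labels w))) (λ s → K s l)
  descendants-E zero z w M M≡ = begin
    descendants M (z ∷ w) 0     ≈⟨ descendants-zero M (z ∷ w) (≡.trans M≡ (Nₚ.+-identityʳ _)) ⟩
    weight (z ∷ w)              ≈⟨ *-identityʳ _ ⟨
    weight (z ∷ w) * 1#
      ≈⟨ *-congˡ (E-constant (map (step (z ∷ w)) (remove z (labels w))) (λ s → K s 0) K-zero) ⟨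
    weight (z ∷ w) * E (map (step (z ∷ w)) (remove z (labels w))) (λ s → K s 0) ∎
  descendants-E (suc l) z w M M≡ = begin
    descendants M zw (suc l)
      ≈⟨ descendants-suc M zw l (≡.subst (l <_) (≡.sym M≡′) (s≤s (Nₚ.m≤n+m l (length zw)))) ⟩
    Σ∈ (childLetters zw) (λ x → descendants M (x ∷ zw) l)
      ≈⟨ Σ∈-cong (childLetters zw) (λ x → trans (descendants-E l x zw M M≡′)
           (trans (*-congʳ (weight-∷ x zw)) (*-assoc _ _ _))) ⟩
    Σ∈ (childLetters zw) (λ x → weight zw * (step zw x * E (map (step (x ∷ zw)) (remove x (labels zw))) k))
      ≈⟨ Σ∈-*ˡ (weight zw) _ (childLetters zw) ⟩
    weight zw * (step zw (fresh zw) * E (map (step (fresh zw ∷ zw)) (remove (fresh zw) (labels zw))) k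
      + Σ∈ (labels zw) (λ x → step zw x * E (map (step (x ∷ zw)) (remove x (labels zw))) k))
      ≈⟨ *-congˡ (+-cong singleton (Σ-step zw (labels zw) (labels-sorted zw) k)) ⟩
    weight zw * (E (map (step zw) (labels zw)) k + E (map (step zw) (labels zw)) (D k))
      ≈⟨ *-congˡ (E-+ (map (step zw) (labels zw)) k (D k)) ⟨
    -- `z` heads `labels zw`, so `E` unfolds there into a part without `z` and a part with it, the
    -- latter with coefficients shifted by one.
    weight zw * (E ys (λ s → k s + D k s) + step zw z * E ys (λ s → k (suc s) + a s * k s))
      ≈⟨ *-congˡ (+-congˡ (trans (*-congʳ (step-first z w)) (*-identityˡ _))) ⟩
    weight zw * (E ys (λ s → k s + D k s) + E ys (λ s → k (suc s) + a s * k s))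
      ≈⟨ *-congˡ (E-+ ys (λ s → k s + D k s) (λ s → k (suc s) + a s * k s)) ⟨
    weight zw * E ys (λ s → k s + D k s + (k (suc s) + a s * k s))
      -- The term `k s` collects 1 from opening a block without `z` chosen and `a s` from joining
      -- with `z` chosen, which makes up `cc s`.
      ≈⟨ *-congˡ (E-cong ys (λ s → trans
           (solve 4 (λ x y z a → x :+ y :+ (z :+ a :* x) := z :+ (a :+ con 1) :* x :+ y) refl (k s) (D k s) (k (suc s)) (a s))
           (sym (K-suc s l)))) ⟩
    weight zw * E ys (λ s → K s (suc l)) ∎
    where
    zw : List ℕ
    zw = z ∷ w
    k : ℕ → Carrier
    k s = K s l
    ys : List Carrier
    ys = map (step zw) (remove z (labels w))
    M≡′ : M ≡ suc (length zw) N.+ l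
    M≡′ = ≡.trans M≡ (Nₚ.+-suc (length zw) l)
    singleton : step zw (fresh zw) * E (map (step (fresh zw ∷ zw)) (remove (fresh zw) (labels zw))) k
                ≈ E (map (step zw) (labels zw)) k
    singleton rewrite remove-absent (fresh∉labels zw) = trans
      (*-cong (step-absent zw (findIdx-fresh zw)) (E-map-cong (All.tabulate (step-fresh zw)) k)) (*-identityˡ _)

  -- The coefficients b_{0,s}

  prodL : List Carrier → Carrier
  prodL = foldr _*_ 1#

  Σ∈-choose : ∀ (f : ℕ → Carrier) r xs → Σ∈ (choose r xs) (λ I → prodL (map f I)) ≈ elem r (map f xs)
  Σ∈-choose f zero    xs       = +-identityʳ 1#
  Σ∈-choose f (suc r) []       = refl
  Σ∈-choose f (suc r) (x ∷ xs) = begin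
    Σ∈ (map (x ∷_) (choose r xs) ++ choose (suc r) xs) (λ I → prodL (map f I))
      ≈⟨ Σ∈-++ _ (map (x ∷_) (choose r xs)) (choose (suc r) xs) ⟩
    Σ∈ (map (x ∷_) (choose r xs)) (λ I → prodL (map f I)) + Σ∈ (choose (suc r) xs) (λ I → prodL (map f I))
      ≈⟨ +-cong (trans (reflexive (Σ∈-map _ (x ∷_) (choose r xs)))
                       (trans (Σ∈-*ˡ (f x) _ (choose r xs)) (*-congˡ (Σ∈-choose f r xs))))
                (Σ∈-choose f (suc r) xs) ⟩
    f x * elem r (map f xs) + elem (suc r) (map f xs) ∎

  sumN-offset : ∀ c (f g : ℕ → ℕ) → (∀ i → f i ≡ c N.+ g i) → ∀ I →
                sumN (map f I) ≡ length I N.* c N.+ sumN (map g I)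
  sumN-offset c f g e []      = ≡.refl
  sumN-offset c f g e (i ∷ I) rewrite e i | sumN-offset c f g e I =
    interchange c (g i) (length I N.* c) (sumN (map g I))

  -- Each of the `suc r` summands contains `c` once and `r * d` removes all but one copy, so the
  -- truncated subtraction is exact.
  sumN-excess : ∀ {c d r} (f g : ℕ → ℕ) → (∀ i → f i ≡ c N.+ g i) → d ≡ c → ∀ I → length I ≡ suc r →
                sumN (map f I) ∸ r N.* d ≡ c N.+ sumN (map g I)
  sumN-excess {c} {r = r} f g e ≡.refl I len rewrite sumN-offset c f g e I | len =
    ≡.trans (≡.cong (_∸ r N.* c) (≡.trans (≡.cong (N._+ sumN (map g I)) (Nₚ.+-comm c (r N.* c))) (Nₚ.+-assoc (r N.* c) c _)))
            (Nₚ.m+n∸m≡n (r N.* c) _)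

  module _ (w : List ℕ) where

    π : List ℕ
    π = 0 ∷ w

    dC dN : ℕ → ℕ
    dC i = newCr (findIdx (i ∸ 1) π) (arcs π)
    dN i = newNe (findIdx (i ∸ 1) π) (arcs π)

    -- The new arc joins the two leftmost elements, so it crosses nothing; by the same reason it
    -- covers nothing in `v₁`. The normalising factor in `b_{0,r}` is thus the weight of `π`.
    u₁ : u π 1 ≡ cr π
    u₁ = ≡.trans (cr-∷ 0 π) (≡.trans (≡.cong (cr π N.+_) (newCr-zero (arcs π))) (Nₚ.+-identityʳ _))

    v₁ : v π 1 ≡ ne π
    v₁ = ≡.trans (ne-∷ 0 π) (≡.trans (≡.cong (ne π N.+_) (newNe-zero (arcs π))) (Nₚ.+-identityʳ _))

    prodL-step : ∀ I → monomial (sumN (map dC I)) (sumN (map dN I)) ≈ prodL (map (λ i → step π (i ∸ 1)) I)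
    prodL-step []      = *-identityˡ 1#
    prodL-step (i ∷ I) = trans (monomial-+ (dC i) _ (dN i) _) (*-congˡ (prodL-step I))

    -- The step of block `i` is `q^{u_i - u_1} p^{v_i - v_1}`, so once one factor `q^{u_1} p^{v_1}`
    -- is taken out, the sum over index sets is elementary symmetric. Block `i` has label `i ∸ 1`,
    -- whence labels 1 to k - 1.
    b0-elem : ∀ s → b0 π s ≈ weight π * elem s (map (step π) (applyUpTo suc (nblocks π ∸ 1)))
    b0-elem zero = begin
      monomial (u π 1) (v π 1)   ≡⟨ ≡.cong₂ monomial u₁ v₁ ⟩
      weight π                   ≈⟨ *-identityʳ _ ⟨
      weight π * 1#              ∎
    b0-elem (suc r) = begin
      b0 π (suc r)
        ≈⟨ Σ∈-cong-All (All.map (λ {I} → term I) (choose-length (suc r) is)) ⟩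
      Σ∈ (choose (suc r) is) (λ I → weight π * prodL (map (λ i → step π (i ∸ 1)) I))
        ≈⟨ Σ∈-*ˡ (weight π) _ (choose (suc r) is) ⟩
      weight π * Σ∈ (choose (suc r) is) (λ I → prodL (map (λ i → step π (i ∸ 1)) I))
        ≈⟨ *-congˡ (Σ∈-choose (λ i → step π (i ∸ 1)) (suc r) is) ⟩
      weight π * elem (suc r) (map (λ i → step π (i ∸ 1)) is)
        ≡⟨ ≡.cong (λ ys → weight π * elem (suc r) ys) steps ⟩
      weight π * elem (suc r) (map (step π) (applyUpTo suc n)) ∎
      where
      n : ℕ
      n = nblocks π ∸ 1
      is : List ℕ
      is = map (2 N.+_) (upTo n)
      steps : map (λ i → step π (i ∸ 1)) is ≡ map (step π) (applyUpTo suc n)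
      steps = ≡.trans (≡.sym (map-∘ (upTo n)))
                (≡.trans (map-upTo (step π ∘ suc) n) (≡.sym (map-applyUpTo suc (step π) n)))
      term : ∀ I → length I ≡ suc r →
             monomial (sumN (map (u π) I) ∸ r N.* u π 1) (sumN (map (v π) I) ∸ r N.* v π 1)
             ≈ weight π * prodL (map (λ i → step π (i ∸ 1)) I)
      term I len = begin
        monomial (sumN (map (u π) I) ∸ r N.* u π 1) (sumN (map (v π) I) ∸ r N.* v π 1)
          ≡⟨ ≡.cong₂ monomial (sumN-excess (u π) dC (λ i → cr-∷ (i ∸ 1) π) u₁ I len)
                              (sumN-excess (v π) dN (λ i → ne-∷ (i ∸ 1) π) v₁ I len) ⟩
        monomial (cr π N.+ sumN (map dC I)) (ne π N.+ sumN (map dN I))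
          ≈⟨ monomial-+ (cr π) _ (ne π) _ ⟩
        weight π * monomial (sumN (map dC I)) (sumN (map dN I))
          ≈⟨ *-congˡ (prodL-step I) ⟩
        weight π * prodL (map (λ i → step π (i ∸ 1)) I) ∎

    Scoeff-RHScoeff : T (isRGS π) → ∀ l → Scoeff π l ≈ RHScoeff π l
    Scoeff-RHScoeff rgs l = begin
      Scoeff π l
        ≈⟨ Σ∈-filter weight _ (words M M) ⟩
      Σ∈ (words M M) (λ v → [ isRGS v ∧ eqList (std (drop l v)) π ] weight v)
        ≡⟨ ≡.cong (λ ρ → Σ∈ (words M M) (λ v → [ isRGS v ∧ eqList (std (drop l v)) ρ ] weight v)) (std-rgs π rgs) ⟨
      descendants M π l
        ≈⟨ descendants-E l 0 w M ≡.refl ⟩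
      weight π * E (map (step π) (remove 0 (labels w))) (λ s → K s l)
        ≡⟨ ≡.cong (λ xs → weight π * E (map (step π) xs) (λ s → K s l)) other-labels ⟩
      weight π * E ys (λ s → K s l)
        ≈⟨ *-congˡ (E-elem ys (λ s → K s l) (nblocks π) bound) ⟩
      weight π * sumTo (nblocks π) (λ s → elem s ys * K s l)
        ≈⟨ Σ∈-*ˡ (weight π) _ (upTo (nblocks π)) ⟨
      sumTo (nblocks π) (λ s → weight π * (elem s ys * K s l))
        ≈⟨ Σ∈-cong (upTo (nblocks π)) (λ s → trans (sym (*-assoc _ _ _)) (*-congʳ (sym (b0-elem s)))) ⟩
      RHScoeff π l ∎
      where
      M : ℕ
      M = length π N.+ l
      ys : List Carrier
      ys = map (step π) (applyUpTo suc (nblocks π ∸ 1))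
      labels≡ : labels π ≡ upTo (nblocks π)
      labels≡ = labels-rgs π rgs
      other-labels : remove 0 (labels w) ≡ applyUpTo suc (nblocks π ∸ 1)
      other-labels with nblocks π | labels≡
      ... | suc n | e = proj₂ (∷-injective e)
      bound : length ys < nblocks π
      bound rewrite length-map (step π) (applyUpTo suc (nblocks π ∸ 1)) | length-applyUpTo suc (nblocks π ∸ 1)
        with nblocks π | labels≡
      ... | suc n | _ = Nₚ.≤-refl

theorem5p2 : {c ℓ : Level} (R : CommutativeRing c ℓ) (q p : CommutativeRing.Carrier R)
    (π : List ℕ) → T (isRGS π) → 1 ≤ nblocks π → (l : ℕ) →
    CommutativeRing._≈_ R (Series.Scoeff R q p π l) (Series.RHScoeff R q p π l)
-- The empty word has no block, and a nonempty restricted growth string starts with 0.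
theorem5p2 R q p (zero ∷ w) rgs _ l = Tree.Scoeff-RHScoeff R q p w rgs l
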